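{- For each $k\ge5$, there are infinitely many (pairwise non-isomorphic) connected non-regular unweighted graphs with maximum valency $k$ that admit pair state transfer, relative to each of $A$, $L$ and $Q$, between the same pair states at time $\frac{\pi}{2}$.
   Context: For an unweighted simple graph $G$ with adjacency matrix $A$ and degree matrix $\Delta$, let $L=\Delta-A$ and $Q=\Delta+A$. For $M\in\{A,L,Q\}$, pair state transfer relative to $M$ at time $\tau$ means that there are vertices $a\ne b$ and $c\neq d$ with $\mathbf{e}_c-\mathbf{e}_d\ne\pm(\mathbf{e}_a-\mathbf{e}_b)$ and some $\gamma\in\mathbb{C}$ such that $\exp(i\tau M)(\mathbf{e}_a-\mathbf{e}_b)=\gamma(\mathbf{e}_c-\mathbf{e}_d)$, where $\mathbf{e}_a$ is the characteristic vector of vertex $a$. "Between the same pair states" means that the same $\mathbf{e}_a-\mathbf{e}_b$ and $\mathbf{e}_c-\mathbf{e}_d$ work for $M=A$, $M=L$ and $M=Q$. -}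

module Defs where

open import Data.Bool.Base using (Bool; T; true; false; if_then_else_)
open import Data.Fin.Base using (Fin; zero; suc)
import Data.Fin.Properties as Fin
open import Data.Fin.Subset as Subset using (Subset)
open import Data.Integer.Base as ℤ using (+_; +[1+_])
import Data.Integer.Properties as ℤ
open import Data.Nat.Base as ℕ using (ℕ; zero; suc; _!; z≤n; s≤s)
import Data.Nat.Properties as ℕ
open import Data.Product.Base using (Σ; Σ-syntax; ∃-syntax; _×_; _,_; proj₁; proj₂)
open import Data.Rational.Base
  using (ℚ; mkℚ; 0ℚ; 1ℚ; ½; _+_; _*_; -_; _-_; _/_; 1/_; ∣_∣; _≤_; _<_; *<*
        ; _≤ᵇ_; positive; nonNegative; toℚᵘ; fromℚᵘ; +-*-rawSemiring)
import Data.Rational.Properties as ℚ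
open import Data.Rational.Solver using (module +-*-Solver)
open import Data.Rational.Unnormalised.Base as ℚᵘ using (mkℚᵘ)
import Data.Rational.Unnormalised.Properties as ℚᵘ
open import Data.Sum.Base using (_⊎_; inj₁; inj₂)
open import Data.Vec.Base using (tabulate)
import Data.Vec.Functional as Vector
open import Function.Bundles using (_↔_; Inverse)
open import Relation.Binary.Construct.Closure.ReflexiveTransitive using (Star)
open import Relation.Binary.PropositionalEquality.Core
  using (_≡_; _≢_; refl; sym; trans; cong; cong₂; subst; subst₂)
open import Relation.Nullary.Decidable.Core using (does)
open import Relation.Nullary.Negation.Core using (¬_)

open import Algebra.Definitions.RawSemiring +-*-rawSemiring
  using () renaming (_×_ to _×ℚ_; _^_ to _^ℚ_)

module ℚ-Lemmas where
  open +-*-Solver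
  open ℚ.≤-Reasoning

  abs-neg-sub : ∀ p q → ∣ (- p) - (- q) ∣ ≡ ∣ p - q ∣
  abs-neg-sub p q = trans (cong ∣_∣ (lemma p q)) (ℚ.∣-p∣≡∣p∣ (p - q))
    where
    lemma : ∀ p q → (- p) - (- q) ≡ - (p - q)
    lemma = solve 2 (λ p q → (:- p) :- (:- q) := :- (p :- q)) refl

  abs-sub-comm : ∀ p q → ∣ p - q ∣ ≡ ∣ q - p ∣
  abs-sub-comm p q = trans (cong ∣_∣ (lemma p q)) (ℚ.∣-p∣≡∣p∣ (q - p))
    where
    lemma : ∀ p q → p - q ≡ - (q - p)
    lemma = solve 2 (λ p q → p :- q := :- (q :- p)) refl

  self-sub : ∀ p → ∣ p - p ∣ ≡ 0ℚ
  self-sub p = cong ∣_∣ (ℚ.+-inverseʳ p)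

  triangle : ∀ p q r → ∣ p - r ∣ ≤ ∣ p - q ∣ + ∣ q - r ∣
  triangle p q r =
    subst (λ s → ∣ s ∣ ≤ ∣ p - q ∣ + ∣ q - r ∣) (lemma p q r)
      (ℚ.∣p+q∣≤∣p∣+∣q∣ (p - q) (q - r))
    where
    lemma : ∀ p q r → (p - q) + (q - r) ≡ p - r
    lemma = solve 3 (λ p q r → (p :- q) :+ (q :- r) := p :- r) refl

  abs-bound : ∀ p q → ∣ p ∣ ≤ ∣ p - q ∣ + ∣ q ∣
  abs-bound p q =
    subst (λ s → ∣ s ∣ ≤ ∣ p - q ∣ + ∣ q ∣) (lemma p q) (ℚ.∣p+q∣≤∣p∣+∣q∣ (p - q) q)
    where
    lemma : ∀ p q → (p - q) + q ≡ p
    lemma = solve 2 (λ p q → (p :- q) :+ q := p) refl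

  abs-reverse-triangle : ∀ p q → ∣ ∣ p ∣ - ∣ q ∣ ∣ ≤ ∣ p - q ∣
  abs-reverse-triangle p q with ℚ.∣p∣≡p∨∣p∣≡-p (∣ p ∣ - ∣ q ∣)
  ... | inj₁ eq = subst (_≤ ∣ p - q ∣) (sym eq) (one-sided p q)
    where
    cancel : ∀ a b → (a + b) - b ≡ a
    cancel = solve 2 (λ a b → (a :+ b) :- b := a) refl
    one-sided : ∀ p q → ∣ p ∣ - ∣ q ∣ ≤ ∣ p - q ∣
    one-sided p q = subst (∣ p ∣ - ∣ q ∣ ≤_) (cancel ∣ p - q ∣ ∣ q ∣)
      (ℚ.+-monoˡ-≤ (- ∣ q ∣) (abs-bound p q))
  ... | inj₂ eq = subst (_≤ ∣ p - q ∣) (sym (trans eq (flip ∣ p ∣ ∣ q ∣)))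
                    (subst (∣ q ∣ - ∣ p ∣ ≤_) (abs-sub-comm q p) (one-sided q p))
    where
    flip : ∀ a b → - (a - b) ≡ b - a
    flip = solve 2 (λ a b → :- (a :- b) := b :- a) refl
    cancel : ∀ a b → (a + b) - b ≡ a
    cancel = solve 2 (λ a b → (a :+ b) :- b := a) refl
    one-sided : ∀ p q → ∣ p ∣ - ∣ q ∣ ≤ ∣ p - q ∣
    one-sided p q = subst (∣ p ∣ - ∣ q ∣ ≤_) (cancel ∣ p - q ∣ ∣ q ∣)
      (ℚ.+-monoˡ-≤ (- ∣ q ∣) (abs-bound p q))

  add-sub : ∀ p q r s → ∣ (p + q) - (r + s) ∣ ≤ ∣ p - r ∣ + ∣ q - s ∣
  add-sub p q r s =
    subst (λ t → ∣ t ∣ ≤ ∣ p - r ∣ + ∣ q - s ∣) (lemma p q r s)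
      (ℚ.∣p+q∣≤∣p∣+∣q∣ (p - r) (q - s))
    where
    lemma : ∀ p q r s → (p - r) + (q - s) ≡ (p + q) - (r + s)
    lemma = solve 4 (λ p q r s → (p :- r) :+ (q :- s) := (p :+ q) :- (r :+ s)) refl

  mul-sub : ∀ p q r s → ∣ p * q - r * s ∣ ≤ ∣ p ∣ * ∣ q - s ∣ + ∣ p - r ∣ * ∣ s ∣
  mul-sub p q r s =
    subst₂ _≤_ (cong ∣_∣ (lemma p q r s))
      (cong₂ _+_ (ℚ.∣p*q∣≡∣p∣*∣q∣ p (q - s)) (ℚ.∣p*q∣≡∣p∣*∣q∣ (p - r) s))
      (ℚ.∣p+q∣≤∣p∣+∣q∣ (p * (q - s)) ((p - r) * s))
    where
    lemma : ∀ p q r s → p * (q - s) + (p - r) * s ≡ p * q - r * s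
    lemma = solve 4 (λ p q r s → p :* (q :- s) :+ (p :- r) :* s := p :* q :- r :* s) refl

  half-pos : ∀ {ε} → 0ℚ < ε → 0ℚ < ε * ½
  half-pos {ε} 0<ε = ℚ.positive⁻¹ (ε * ½) {{ℚ.pos*pos⇒pos ε {{positive 0<ε}} ½}}

  half+half : ∀ ε → ε * ½ + ε * ½ ≡ ε
  half+half = solve 1 (λ ε → ε :* con ½ :+ ε :* con ½ := ε) refl

  *-mono : ∀ {p q r s} → 0ℚ ≤ q → 0ℚ ≤ r → p ≤ q → r ≤ s → p * r ≤ q * s
  *-mono {p} {q} {r} {s} 0≤q 0≤r p≤q r≤s = ℚ.≤-trans
    (ℚ.*-monoʳ-≤-nonNeg r {{nonNegative 0≤r}} p≤q)
    (ℚ.*-monoˡ-≤-nonNeg q {{nonNegative 0≤q}} r≤s)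

  *-nonNeg : ∀ {p q} → 0ℚ ≤ p → 0ℚ ≤ q → 0ℚ ≤ p * q
  *-nonNeg {p} {q} 0≤p 0≤q = ℚ.nonNegative⁻¹ (p * q)
    {{ℚ.nonNeg*nonNeg⇒nonNeg p {{nonNegative 0≤p}} q {{nonNegative 0≤q}}}}

  +-nonNeg : ∀ {p q} → 0ℚ ≤ p → 0ℚ ≤ q → 0ℚ ≤ p + q
  +-nonNeg 0≤p 0≤q = ℚ.+-mono-≤ 0≤p 0≤q

  +-pos : ∀ {p q} → 0ℚ < p → 0ℚ < q → 0ℚ < p + q
  +-pos 0<p 0<q = ℚ.+-mono-< 0<p 0<q

  *-pos : ∀ {p q} → 0ℚ < p → 0ℚ < q → 0ℚ < p * q
  *-pos {p} {q} 0<p 0<q = ℚ.positive⁻¹ (p * q)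
    {{ℚ.pos*pos⇒pos p {{positive 0<p}} q {{positive 0<q}}}}

  ≤-weaken : ∀ {p q r} → p ≤ q → 0ℚ ≤ r → p ≤ q + r
  ≤-weaken {p} {q} {r} p≤q 0≤r = subst (_≤ q + r) (ℚ.+-identityʳ p) (ℚ.+-mono-≤ p≤q 0≤r)

  widen : ∀ {p q r} → q ≡ r → p ≤ q → p ≤ r
  widen {p} q≡r p≤q = subst (p ≤_) q≡r p≤q

  recip : ∀ {q} → 0ℚ < q → ∃[ r ] 0ℚ < r × r * q ≡ 1ℚ
  recip {q} 0<q = (1/ q) {{q≢0}} ,
    ℚ.positive⁻¹ ((1/ q) {{q≢0}}) {{ℚ.1/pos⇒pos q {{positive 0<q}}}} , ℚ.*-inverseˡ q {{q≢0}}
    where q≢0 = ℚ.pos⇒nonZero q {{positive 0<q}}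

  0<1 : 0ℚ < 1ℚ
  0<1 = ℚ.positive⁻¹ 1ℚ

  unit : ℕ → ℚ
  unit n = + 1 / suc n

  unit-pos : ∀ n → 0ℚ < unit n
  unit-pos n = ℚ.positive⁻¹ (unit n) {{ℚ.normalize-pos 1 (suc n)}}

  unit-small : ∀ ε → 0ℚ < ε → ∃[ N ] ∀ n → N ℕ.≤ n → unit n ≤ ε
  unit-small ε@(mkℚ +[1+ a ] d _) 0<ε = d , λ n d≤n → ℚ.toℚᵘ-cancel-≤
    (ℚᵘ.≤-respˡ-≃ (ℚᵘ.≃-sym (ℚ.toℚᵘ-fromℚᵘ (mkℚᵘ (+ 1) n)))
      (ℚᵘ.*≤* (ℤ.+≤+ (ℕ.*-mono-≤ {1} {suc a} (s≤s z≤n) (s≤s d≤n)))))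
  unit-small (mkℚ (+ 0) d _)      (*<* (ℤ.+<+ ()))
  unit-small (mkℚ ℤ.-[1+ a ] d _) (*<* ())

  half-unit : ∀ n → unit n * ½ ≤ unit (suc n)
  half-unit n = ℚ.toℚᵘ-cancel-≤
    (ℚᵘ.≤-respˡ-≃ (ℚᵘ.≃-sym lhs)
      (ℚᵘ.≤-respʳ-≃ (ℚᵘ.≃-sym (ℚ.toℚᵘ-fromℚᵘ (mkℚᵘ (+ 1) (suc n))))
        (ℚᵘ.*≤* (ℤ.+≤+ (subst₂ ℕ._≤_ (sym (ℕ.*-identityˡ (suc (suc n)))) (sym (ℕ.*-identityˡ _))
          (s≤s (s≤s (ℕ.m≤m*n n 2))))))))
    where
    lhs : toℚᵘ (unit n * ½) ℚᵘ.≃ mkℚᵘ (+ 1) n ℚᵘ.* mkℚᵘ (+ 1) 1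
    lhs = ℚᵘ.≃-trans (ℚ.toℚᵘ-homo-* (unit n) ½)
      (ℚᵘ.*-congʳ {mkℚᵘ (+ 1) 1} (ℚ.toℚᵘ-fromℚᵘ (mkℚᵘ (+ 1) n)))

  recip-* : ∀ m n .{{_ : ℕ.NonZero m}} .{{_ : ℕ.NonZero n}} .{{_ : ℕ.NonZero (m ℕ.* n)}} →
            + 1 / (m ℕ.* n) ≡ (+ 1 / m) * (+ 1 / n)
  recip-* (suc m) (suc n) = ℚ.toℚᵘ-injective
    (ℚᵘ.≃-trans (ℚ.toℚᵘ-fromℚᵘ (mkℚᵘ (+ 1) (n ℕ.+ m ℕ.* suc n)))
      (ℚᵘ.≃-sym (ℚᵘ.≃-trans (ℚ.toℚᵘ-homo-* (+ 1 / suc m) (+ 1 / suc n))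
        (ℚᵘ.*-cong (ℚ.toℚᵘ-fromℚᵘ (mkℚᵘ (+ 1) m)) (ℚ.toℚᵘ-fromℚᵘ (mkℚᵘ (+ 1) n))))))

open ℚ-Lemmas

Eventually : (ℕ → Set) → Set
Eventually P = ∃[ N ] ∀ n → N ℕ.≤ n → P n

both : ∀ {P Q R : ℕ → Set} → (∀ n → P n → Q n → R n) →
       Eventually P → Eventually Q → Eventually R
both f (M , p) (N , q) = M ℕ.⊔ N , λ n M⊔N≤n →
  f n (p n (ℕ.m⊔n≤o⇒m≤o M N M⊔N≤n)) (q n (ℕ.m⊔n≤o⇒n≤o M N M⊔N≤n))

each : ∀ {P Q : ℕ → Set} → (∀ n → P n → Q n) → Eventually P → Eventually Q
each f (N , p) = N , λ n N≤n → f n (p n N≤n)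

IsCauchy : (ℕ → ℚ) → Set
IsCauchy p = ∀ ε → 0ℚ < ε → ∃[ N ] ∀ m n → N ℕ.≤ m → N ℕ.≤ n → ∣ p m - p n ∣ ≤ ε

-- Equality of reals is the relation _≈ᴿ_ below, not _≡_.
record ℝ : Set where
  constructor mkℝ
  field
    approx : ℕ → ℚ
    cauchy : IsCauchy approx

open ℝ public

infix  8 -ᴿ_
infixl 7 _*ᴿ_
infixl 6 _+ᴿ_ _-ᴿ_
infix  4 _≈ᴿ_ _≤ᴿ_ _<ᴿ_ _⟶_

_≈ᴿ_ : ℝ → ℝ → Set
x ≈ᴿ y = ∀ ε → 0ℚ < ε → Eventually λ n → ∣ approx x n - approx y n ∣ ≤ ε

_≤ᴿ_ : ℝ → ℝ → Set
x ≤ᴿ y = ∀ ε → 0ℚ < ε → Eventually λ n → approx x n ≤ approx y n + ε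

_<ᴿ_ : ℝ → ℝ → Set
x <ᴿ y = ∃[ ε ] 0ℚ < ε × Eventually λ n → approx x n + ε ≤ approx y n

abstract
  const-cauchy : ∀ q → IsCauchy (λ _ → q)
  const-cauchy q ε 0<ε = 0 , λ _ _ _ _ → subst (_≤ ε) (sym (self-sub q)) (ℚ.<⇒≤ 0<ε)

  +-cauchy : ∀ x y → IsCauchy (λ n → approx x n + approx y n)
  +-cauchy (mkℝ p p-cauchy) (mkℝ q q-cauchy) ε 0<ε =
    let M , p-close = p-cauchy (ε * ½) (half-pos 0<ε)
        N , q-close = q-cauchy (ε * ½) (half-pos 0<ε)
    in M ℕ.⊔ N , λ m n ≤m ≤n → ℚ.≤-trans (add-sub (p m) (q m) (p n) (q n))
         (widen (half+half ε) (ℚ.+-mono-≤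
           (p-close m n (ℕ.m⊔n≤o⇒m≤o M N ≤m) (ℕ.m⊔n≤o⇒m≤o M N ≤n))
           (q-close m n (ℕ.m⊔n≤o⇒n≤o M N ≤m) (ℕ.m⊔n≤o⇒n≤o M N ≤n))))

  neg-cauchy : ∀ x → IsCauchy (λ n → - approx x n)
  neg-cauchy (mkℝ p p-cauchy) ε 0<ε =
    let N , close = p-cauchy ε 0<ε
    in N , λ m n ≤m ≤n → subst (_≤ ε) (sym (abs-neg-sub (p m) (p n))) (close m n ≤m ≤n)

  abs-cauchy : ∀ x → IsCauchy (λ n → ∣ approx x n ∣)
  abs-cauchy (mkℝ p p-cauchy) ε 0<ε =
    let N , close = p-cauchy ε 0<ε
    in N , λ m n ≤m ≤n → ℚ.≤-trans (abs-reverse-triangle (p m) (p n)) (close m n ≤m ≤n)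

  bounded : ∀ x → ∃[ B ] 0ℚ < B × Eventually λ n → ∣ approx x n ∣ ≤ B
  bounded (mkℝ p p-cauchy) =
    let N , close = p-cauchy 1ℚ 0<1
    in 1ℚ + ∣ p N ∣ , ℚ.+-mono-<-≤ 0<1 (ℚ.0≤∣p∣ (p N)) , N , λ n N≤n →
         ℚ.≤-trans (abs-bound (p n) (p N)) (ℚ.+-monoˡ-≤ ∣ p N ∣ (close n N N≤n ℕ.≤-refl))

  *-cauchy : ∀ x y → IsCauchy (λ n → approx x n * approx y n)
  *-cauchy (mkℝ p p-cauchy) (mkℝ q q-cauchy) ε 0<ε =
    let A , 0<A , K , p≤A = bounded (mkℝ p p-cauchy)
        B , 0<B , L , q≤B = bounded (mkℝ q q-cauchy)
        r , 0<r , r*[A+B]≡1 = recip (+-pos 0<A 0<B)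
        δ = ε * r
        0<δ = *-pos 0<ε 0<r
        M , p-close = p-cauchy δ 0<δ
        N , q-close = q-cauchy δ 0<δ
        total : A * δ + δ * B ≡ ε
        total = trans (lemma A B ε r) (trans (cong (ε *_) r*[A+B]≡1) (ℚ.*-identityʳ ε))
    in (K ℕ.⊔ L) ℕ.⊔ (M ℕ.⊔ N) , λ m n ≤m ≤n →
         let K⊔L≤m = ℕ.m⊔n≤o⇒m≤o (K ℕ.⊔ L) (M ℕ.⊔ N) ≤m
             K⊔L≤n = ℕ.m⊔n≤o⇒m≤o (K ℕ.⊔ L) (M ℕ.⊔ N) ≤n
             M⊔N≤m = ℕ.m⊔n≤o⇒n≤o (K ℕ.⊔ L) (M ℕ.⊔ N) ≤m
             M⊔N≤n = ℕ.m⊔n≤o⇒n≤o (K ℕ.⊔ L) (M ℕ.⊔ N) ≤n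
         in ℚ.≤-trans (mul-sub (p m) (q m) (p n) (q n))
              (widen total (ℚ.+-mono-≤
                (*-mono (ℚ.<⇒≤ 0<A) (ℚ.0≤∣p∣ (q m - q n))
                  (p≤A m (ℕ.m⊔n≤o⇒m≤o K L K⊔L≤m))
                  (q-close m n (ℕ.m⊔n≤o⇒n≤o M N M⊔N≤m) (ℕ.m⊔n≤o⇒n≤o M N M⊔N≤n)))
                (*-mono (ℚ.<⇒≤ 0<δ) (ℚ.0≤∣p∣ (q n))
                  (p-close m n (ℕ.m⊔n≤o⇒m≤o M N M⊔N≤m) (ℕ.m⊔n≤o⇒m≤o M N M⊔N≤n))
                  (q≤B n (ℕ.m⊔n≤o⇒n≤o K L K⊔L≤n)))))
    where
    open +-*-Solver
    lemma : ∀ A B ε r → A * (ε * r) + (ε * r) * B ≡ ε * (r * (A + B))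
    lemma = solve 4 (λ A B ε r → A :* (ε :* r) :+ (ε :* r) :* B := ε :* (r :* (A :+ B))) refl

fromℚ : ℚ → ℝ
fromℚ q = mkℝ (λ _ → q) (const-cauchy q)

0ᴿ 1ᴿ : ℝ
0ᴿ = fromℚ 0ℚ
1ᴿ = fromℚ 1ℚ

_+ᴿ_ : ℝ → ℝ → ℝ
x +ᴿ y = mkℝ (λ n → approx x n + approx y n) (+-cauchy x y)

-ᴿ_ : ℝ → ℝ
-ᴿ x = mkℝ (λ n → - approx x n) (neg-cauchy x)

_-ᴿ_ : ℝ → ℝ → ℝ
x -ᴿ y = x +ᴿ (-ᴿ y)

_*ᴿ_ : ℝ → ℝ → ℝ
x *ᴿ y = mkℝ (λ n → approx x n * approx y n) (*-cauchy x y)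

∣_∣ᴿ : ℝ → ℝ
∣ x ∣ᴿ = mkℝ (λ n → ∣ approx x n ∣) (abs-cauchy x)

_⟶_ : (ℕ → ℝ) → ℝ → Set
s ⟶ l = ∀ ε → 0ℚ < ε → Eventually λ n → ∣ s n -ᴿ l ∣ᴿ ≤ᴿ fromℚ ε

IsCauchyᴿ : (ℕ → ℝ) → Set
IsCauchyᴿ s = ∀ ε → 0ℚ < ε →
  ∃[ N ] ∀ m n → N ℕ.≤ m → N ℕ.≤ n → ∣ s m -ᴿ s n ∣ᴿ ≤ᴿ fromℚ ε

complete : ∀ s → IsCauchyᴿ s → Σ[ l ∈ ℝ ] s ⟶ l
complete s s-cauchy = l , s⟶l
  where
  open +-*-Solver

  modulus : ℕ → ℕ
  modulus n = proj₁ (cauchy (s n) (unit n) (unit-pos n))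

  diagonal : ℕ → ℚ
  diagonal n = approx (s n) (modulus n)

  near-diagonal : ∀ n k → modulus n ℕ.≤ k → ∣ approx (s n) k - diagonal n ∣ ≤ unit n
  near-diagonal n k ≤k = proj₂ (cauchy (s n) (unit n) (unit-pos n)) k (modulus n) ≤k ℕ.≤-refl

  split : ∀ p q r t → ∣ p - t ∣ ≤ ∣ p - q ∣ + (∣ q - r ∣ + ∣ r - t ∣)
  split p q r t = ℚ.≤-trans (triangle p q t) (ℚ.+-monoʳ-≤ ∣ p - q ∣ (triangle q r t))

  diagonal-cauchy : IsCauchy diagonal
  diagonal-cauchy ε 0<ε = M ℕ.⊔ N , λ m n ≤m ≤n →
    let M≤m = ℕ.m⊔n≤o⇒m≤o M N ≤m
        M≤n = ℕ.m⊔n≤o⇒m≤o M N ≤n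
        K , close = s-close m n (ℕ.m⊔n≤o⇒n≤o M N ≤m) (ℕ.m⊔n≤o⇒n≤o M N ≤n) δ 0<δ
        k = K ℕ.⊔ (modulus m ℕ.⊔ modulus n)
        mods≤k = ℕ.m≤n⊔m K (modulus m ℕ.⊔ modulus n)
    in ℚ.≤-trans (split (diagonal m) (approx (s m) k) (approx (s n) k) (diagonal n))
       (widen (quarters ε) (ℚ.+-mono-≤
         (subst (_≤ δ) (abs-sub-comm (approx (s m) k) (diagonal m))
           (ℚ.≤-trans (near-diagonal m k (ℕ.m⊔n≤o⇒m≤o (modulus m) (modulus n) mods≤k)) (small m M≤m)))
         (ℚ.+-mono-≤
           (close k (ℕ.m≤m⊔n K (modulus m ℕ.⊔ modulus n)))
           (ℚ.≤-trans (near-diagonal n k (ℕ.m⊔n≤o⇒n≤o (modulus m) (modulus n) mods≤k)) (small n M≤n)))))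
    where
    δ = ε * ½ * ½
    0<δ = half-pos (half-pos 0<ε)
    M = proj₁ (unit-small δ 0<δ)
    small = proj₂ (unit-small δ 0<δ)
    N = proj₁ (s-cauchy δ 0<δ)
    s-close = proj₂ (s-cauchy δ 0<δ)
    quarters : ∀ ε → ε * ½ * ½ + ((ε * ½ * ½ + ε * ½ * ½) + ε * ½ * ½) ≡ ε
    quarters = solve 1 (λ ε → let δ = ε :* con ½ :* con ½ in
      δ :+ ((δ :+ δ) :+ δ) := ε) refl

  l : ℝ
  l = mkℝ diagonal diagonal-cauchy

  s⟶l : s ⟶ l
  s⟶l ε 0<ε = N , λ n N≤n δ′ 0<δ′ →
    let δ = δ′ * ½ * ½
        0<δ = half-pos (half-pos 0<δ′)
        K , slow = cauchy (s n) δ 0<δ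
        M , small = unit-small δ 0<δ
    in N ℕ.⊔ (K ℕ.⊔ M) , λ k ≤k →
       let N≤k = ℕ.m⊔n≤o⇒m≤o N (K ℕ.⊔ M) ≤k
           K⊔M≤k = ℕ.m⊔n≤o⇒n≤o N (K ℕ.⊔ M) ≤k
           K≤k = ℕ.m⊔n≤o⇒m≤o K M K⊔M≤k
           M≤k = ℕ.m⊔n≤o⇒n≤o K M K⊔M≤k
           J , close = s-close n k N≤n N≤k (δ′ * ½) (half-pos 0<δ′)
           j = J ℕ.⊔ (K ℕ.⊔ modulus k)
           K⊔mod≤j = ℕ.m≤n⊔m J (K ℕ.⊔ modulus k)
       in ℚ.≤-trans (split (approx (s n) k) (approx (s n) j) (approx (s k) j) (diagonal k))
          (widen (shares ε δ′) (ℚ.+-mono-≤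
            (slow k j K≤k (ℕ.m⊔n≤o⇒m≤o K (modulus k) K⊔mod≤j))
            (ℚ.+-mono-≤
              (close j (ℕ.m≤m⊔n J (K ℕ.⊔ modulus k)))
              (ℚ.≤-trans (near-diagonal k j (ℕ.m⊔n≤o⇒n≤o K (modulus k) K⊔mod≤j)) (small k M≤k)))))
    where
    N = proj₁ (s-cauchy ε 0<ε)
    s-close = proj₂ (s-cauchy ε 0<ε)
    shares : ∀ ε δ → δ * ½ * ½ + ((ε + δ * ½) + δ * ½ * ½) ≡ ε + δ
    shares = solve 2 (λ ε δ →
      δ :* con ½ :* con ½ :+ ((ε :+ δ :* con ½) :+ δ :* con ½ :* con ½) := ε :+ δ) refl

record ∣_∣≲_ (x : ℝ) (q : ℚ) : Set where
  constructor mk≲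
  field eventually : Eventually λ n → ∣ approx x n ∣ ≤ q

open ∣_∣≲_

≲-fromℚ : ∀ q → ∣ fromℚ q ∣≲ ∣ q ∣
≲-fromℚ q = mk≲ (0 , λ _ _ → ℚ.≤-refl)

≲-weaken : ∀ {x p q} → p ≤ q → ∣ x ∣≲ p → ∣ x ∣≲ q
≲-weaken p≤q (mk≲ (N , b)) = mk≲ (N , λ n N≤n → ℚ.≤-trans (b n N≤n) p≤q)

≲-+ : ∀ {x y p q} → ∣ x ∣≲ p → ∣ y ∣≲ q → ∣ x +ᴿ y ∣≲ (p + q)
≲-+ {x} {y} {p} {q} (mk≲ b) (mk≲ c) = mk≲ (both step b c)
  where
  step : ∀ n → ∣ approx x n ∣ ≤ p → ∣ approx y n ∣ ≤ q → ∣ approx x n + approx y n ∣ ≤ p + q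
  step n b c = ℚ.≤-trans (ℚ.∣p+q∣≤∣p∣+∣q∣ (approx x n) (approx y n)) (ℚ.+-mono-≤ b c)

≲-neg : ∀ {x p} → ∣ x ∣≲ p → ∣ -ᴿ x ∣≲ p
≲-neg {x} {p} (mk≲ (N , b)) = mk≲ (N , λ n N≤n →
  subst (_≤ p) (sym (ℚ.∣-p∣≡∣p∣ (approx x n))) (b n N≤n))

≲-* : ∀ {x y p q} → 0ℚ ≤ p → ∣ x ∣≲ p → ∣ y ∣≲ q → ∣ x *ᴿ y ∣≲ (p * q)
≲-* {x} {y} {p} {q} 0≤p (mk≲ b) (mk≲ c) = mk≲ (both step b c)
  where
  step : ∀ n → ∣ approx x n ∣ ≤ p → ∣ approx y n ∣ ≤ q → ∣ approx x n * approx y n ∣ ≤ p * q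
  step n b c = subst (_≤ p * q) (sym (ℚ.∣p*q∣≡∣p∣*∣q∣ (approx x n) (approx y n)))
    (*-mono 0≤p (ℚ.0≤∣p∣ (approx y n)) b c)

module Decay
  (t : ℕ → ℚ) (0≤t : ∀ n → 0ℚ ≤ t n)
  (N₀ : ℕ) (halving : ∀ n → N₀ ℕ.≤ n → t (suc n) + t (suc n) ≤ t n)
  where
  open +-*-Solver

  decay : ∀ d → t (d ℕ.+ N₀) ≤ t N₀ * unit d
  decay zero = ℚ.≤-reflexive (sym (ℚ.*-identityʳ (t N₀)))
  decay (suc d) = ℚ.≤-trans (half-≤ (t (suc d ℕ.+ N₀)) (t (d ℕ.+ N₀)) (halving (d ℕ.+ N₀) (ℕ.m≤n+m N₀ d)))
    (ℚ.≤-trans (ℚ.*-monoʳ-≤-nonNeg ½ (decay d))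
      (subst (_≤ t N₀ * unit (suc d)) (sym (ℚ.*-assoc (t N₀) (unit d) ½))
        (ℚ.*-monoˡ-≤-nonNeg (t N₀) {{nonNegative (0≤t N₀)}} (half-unit d))))
    where
    half-≤ : ∀ p q → p + p ≤ q → p ≤ q * ½
    half-≤ p q 2p≤q = subst (_≤ q * ½) (lemma p) (ℚ.*-monoʳ-≤-nonNeg ½ 2p≤q)
      where
      lemma : ∀ p → (p + p) * ½ ≡ p
      lemma = solve 1 (λ p → (p :+ p) :* con ½ := p) refl

  vanish : ∀ ε → 0ℚ < ε → Eventually λ n → t n ≤ ε
  vanish ε 0<ε = M ℕ.+ N₀ , λ n ≤n →
    subst (λ k → t k ≤ ε) (ℕ.m∸n+n≡m (ℕ.≤-trans (ℕ.m≤n+m N₀ M) ≤n))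
      (bound (n ℕ.∸ N₀) (subst (ℕ._≤ n ℕ.∸ N₀) (ℕ.m+n∸n≡m M N₀) (ℕ.∸-monoˡ-≤ N₀ ≤n)))
    where
    reciprocal = recip (ℚ.+-mono-≤-< (0≤t N₀) 0<1)
    r = proj₁ reciprocal
    0<r : 0ℚ < r
    0<r = proj₁ (proj₂ reciprocal)
    r*[T+1]≡1 : r * (t N₀ + 1ℚ) ≡ 1ℚ
    r*[T+1]≡1 = proj₂ (proj₂ reciprocal)
    M = proj₁ (unit-small (ε * r) (*-pos 0<ε 0<r))
    small = proj₂ (unit-small (ε * r) (*-pos 0<ε 0<r))
    lemma : ∀ T ε r → (T + 1ℚ) * (ε * r) ≡ ε * (r * (T + 1ℚ))
    lemma = solve 3 (λ T ε r → (T :+ con 1ℚ) :* (ε :* r) := ε :* (r :* (T :+ con 1ℚ))) refl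
    bound : ∀ d → M ℕ.≤ d → t (d ℕ.+ N₀) ≤ ε
    bound d M≤d = ℚ.≤-trans (decay d) (widen
      (trans (lemma (t N₀) ε r) (trans (cong (ε *_) r*[T+1]≡1) (ℚ.*-identityʳ ε)))
      (*-mono (+-nonNeg (0≤t N₀) (ℚ.<⇒≤ 0<1)) (ℚ.<⇒≤ (unit-pos d))
        (≤-weaken (ℚ.≤-refl {t N₀}) (ℚ.<⇒≤ 0<1)) (small d M≤d)))

module Comparison
  (s z : ℕ → ℝ) (t : ℕ → ℚ)
  (s-suc : ∀ n → s (suc n) ≡ s n +ᴿ z n)
  (z≲t : ∀ n → ∣ z n ∣≲ t n)
  (0≤t : ∀ n → 0ℚ ≤ t n)
  (N₀ : ℕ) (halving : ∀ n → N₀ ℕ.≤ n → t (suc n) + t (suc n) ≤ t n)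
  where
  open +-*-Solver
  open Decay t 0≤t N₀ halving public

  tail : ∀ d m → N₀ ℕ.≤ m →
         ∣ s (d ℕ.+ m) -ᴿ s m ∣≲ ((t m + t m) - (t (d ℕ.+ m) + t (d ℕ.+ m)))
  tail zero m N₀≤m = mk≲ (0 , λ n _ →
    ℚ.≤-reflexive (trans (self-sub (approx (s m) n)) (sym (ℚ.+-inverseʳ (t m + t m)))))
  tail (suc d) m N₀≤m = subst (λ x → ∣ x -ᴿ s m ∣≲ target) (sym (s-suc (d ℕ.+ m)))
    (mk≲ (both step (eventually (tail d m N₀≤m)) (eventually (z≲t (d ℕ.+ m)))))
    where
    target = (t m + t m) - (t (suc d ℕ.+ m) + t (suc d ℕ.+ m))
    split : ∀ a b c → ∣ (a + b) - c ∣ ≤ ∣ a - c ∣ + ∣ b ∣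
    split a b c = subst (λ e → ∣ e ∣ ≤ ∣ a - c ∣ + ∣ b ∣) (lemma a b c) (ℚ.∣p+q∣≤∣p∣+∣q∣ (a - c) b)
      where
      lemma : ∀ a b c → (a - c) + b ≡ (a + b) - c
      lemma = solve 3 (λ a b c → (a :- c) :+ b := (a :+ b) :- c) refl
    absorb : ∀ a b c → c + c ≤ b → (a - (b + b)) + b ≤ a - (c + c)
    absorb a b c 2c≤b = subst (_≤ a - (c + c)) (lemma a b)
      (ℚ.+-monoʳ-≤ a (ℚ.neg-antimono-≤ 2c≤b))
      where
      lemma : ∀ a b → a - b ≡ (a - (b + b)) + b
      lemma = solve 2 (λ a b → a :- b := (a :- (b :+ b)) :+ b) refl
    step : ∀ n → ∣ approx (s (d ℕ.+ m)) n - approx (s m) n ∣ ≤ (t m + t m) - (t (d ℕ.+ m) + t (d ℕ.+ m)) →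
           ∣ approx (z (d ℕ.+ m)) n ∣ ≤ t (d ℕ.+ m) →
           ∣ (approx (s (d ℕ.+ m)) n + approx (z (d ℕ.+ m)) n) - approx (s m) n ∣ ≤ target
    step n ih b = ℚ.≤-trans
      (split (approx (s (d ℕ.+ m)) n) (approx (z (d ℕ.+ m)) n) (approx (s m) n))
      (ℚ.≤-trans (ℚ.+-mono-≤ ih b)
        (absorb (t m + t m) (t (d ℕ.+ m)) (t (suc d ℕ.+ m))
          (halving (d ℕ.+ m) (ℕ.≤-trans N₀≤m (ℕ.m≤n+m m d)))))

  tail-≤ : ∀ m n → N₀ ℕ.≤ m → m ℕ.≤ n → ∣ s n -ᴿ s m ∣≲ (t m + t m)
  tail-≤ m n N₀≤m m≤n = ≲-weaken (drop (t m + t m) (t n) (0≤t n))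
    (subst (λ k → ∣ s k -ᴿ s m ∣≲ ((t m + t m) - (t k + t k))) (ℕ.m∸n+n≡m m≤n)
      (tail (n ℕ.∸ m) m N₀≤m))
    where
    drop : ∀ a b → 0ℚ ≤ b → a - (b + b) ≤ a
    drop a b 0≤b = subst (a - (b + b) ≤_) (ℚ.+-identityʳ a)
      (ℚ.+-monoʳ-≤ a (ℚ.neg-antimono-≤ (+-nonNeg 0≤b 0≤b)))

  partial-sums-cauchy : IsCauchyᴿ s
  partial-sums-cauchy ε 0<ε = M ℕ.⊔ N₀ , λ m n ≤m ≤n → loosen (close m n ≤m ≤n (ℕ.≤-total m n))
    where
    M = proj₁ (vanish (ε * ½) (half-pos 0<ε))
    small = proj₂ (vanish (ε * ½) (half-pos 0<ε))
    loosen : ∀ {x} → ∣ x ∣≲ ε → ∣ x ∣ᴿ ≤ᴿ fromℚ ε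
    loosen (mk≲ (N , b)) δ 0<δ = N , λ k N≤k → ≤-weaken (b k N≤k) (ℚ.<⇒≤ 0<δ)
    backward : ∀ m n → M ℕ.⊔ N₀ ℕ.≤ m → m ℕ.≤ n → ∣ s n -ᴿ s m ∣≲ ε
    backward m n ≤m m≤n = ≲-weaken
      (widen (half+half ε) (ℚ.+-mono-≤ small-m small-m))
      (tail-≤ m n (ℕ.m⊔n≤o⇒n≤o M N₀ ≤m) m≤n)
      where small-m = small m (ℕ.m⊔n≤o⇒m≤o M N₀ ≤m)
    flip : ∀ {m n} → ∣ s n -ᴿ s m ∣≲ ε → ∣ s m -ᴿ s n ∣≲ ε
    flip {m} {n} (mk≲ (N , b)) = mk≲ (N , λ k N≤k →
      subst (_≤ ε) (abs-sub-comm (approx (s n) k) (approx (s m) k)) (b k N≤k))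
    close : ∀ m n → M ℕ.⊔ N₀ ℕ.≤ m → M ℕ.⊔ N₀ ℕ.≤ n → m ℕ.≤ n ⊎ n ℕ.≤ m → ∣ s m -ᴿ s n ∣≲ ε
    close m n ≤m ≤n (inj₂ n≤m) = backward n m ≤n n≤m
    close m n ≤m ≤n (inj₁ m≤n) = flip (backward m n ≤m m≤n)

record ℂ : Set where
  constructor _+i_
  field
    re im : ℝ

open ℂ public

infixl 7 _*ᶜ_
infixl 6 _+ᶜ_ _-ᶜ_
infixr 7 _·ᶜ_
infix  5 _+i_
infix  4 _≈ᶜ_ _⟶ᶜ_

_≈ᶜ_ : ℂ → ℂ → Set
z ≈ᶜ w = re z ≈ᴿ re w × im z ≈ᴿ im w

fromℝ : ℝ → ℂ
fromℝ x = x +i 0ᴿ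

fromℕ : ℕ → ℂ
fromℕ n = fromℝ (fromℚ (+ n / 1))

0ᶜ 1ᶜ 𝕚 : ℂ
0ᶜ = fromℝ 0ᴿ
1ᶜ = fromℝ 1ᴿ
𝕚  = 0ᴿ +i 1ᴿ

_+ᶜ_ : ℂ → ℂ → ℂ
z +ᶜ w = (re z +ᴿ re w) +i (im z +ᴿ im w)

-ᶜ_ : ℂ → ℂ
-ᶜ z = (-ᴿ re z) +i (-ᴿ im z)

_-ᶜ_ : ℂ → ℂ → ℂ
z -ᶜ w = z +ᶜ (-ᶜ w)

_*ᶜ_ : ℂ → ℂ → ℂ
z *ᶜ w = (re z *ᴿ re w -ᴿ im z *ᴿ im w) +i (re z *ᴿ im w +ᴿ im z *ᴿ re w)

_·ᶜ_ : ℝ → ℂ → ℂ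
x ·ᶜ z = (x *ᴿ re z) +i (x *ᴿ im z)

_⟶ᶜ_ : (ℕ → ℂ) → ℂ → Set
s ⟶ᶜ l = ((λ n → re (s n)) ⟶ re l) × ((λ n → im (s n)) ⟶ im l)

partialSum : (ℕ → ℂ) → ℕ → ℂ
partialSum f zero    = 0ᶜ
partialSum f (suc n) = partialSum f n +ᶜ f n

sumᶜ : ∀ {n} → Vector.Vector ℂ n → ℂ
sumᶜ = Vector.foldr _+ᶜ_ 0ᶜ

Vec : ℕ → Set
Vec n = Vector.Vector ℂ n

Matrix : ℕ → Set
Matrix n = Fin n → Fin n → ℂ

infixl 7 _*ᴹ_ _*ᵛ_
infixr 7 _·ᴹ_ _·ᵛ_
infixl 6 _+ᴹ_ _-ᴹ_ _-ᵛ_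
infixr 8 _^ᴹ_
infix  4 _≈ᵛ_

_≈ᵛ_ : ∀ {n} → Vec n → Vec n → Set
u ≈ᵛ v = ∀ x → u x ≈ᶜ v x

_-ᵛ_ : ∀ {n} → Vec n → Vec n → Vec n
(u -ᵛ v) x = u x -ᶜ v x

-ᵛ_ : ∀ {n} → Vec n → Vec n
(-ᵛ u) x = -ᶜ u x

_·ᵛ_ : ∀ {n} → ℂ → Vec n → Vec n
(c ·ᵛ u) x = c *ᶜ u x

_+ᴹ_ _-ᴹ_ _*ᴹ_ : ∀ {n} → Matrix n → Matrix n → Matrix n
(X +ᴹ Y) a b = X a b +ᶜ Y a b
(X -ᴹ Y) a b = X a b -ᶜ Y a b
(X *ᴹ Y) a b = sumᶜ λ c → X a c *ᶜ Y c b

_·ᴹ_ : ∀ {n} → ℂ → Matrix n → Matrix n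
(c ·ᴹ X) a b = c *ᶜ X a b

_*ᵛ_ : ∀ {n} → Matrix n → Vec n → Vec n
(X *ᵛ u) a = sumᶜ λ b → X a b *ᶜ u b

e : ∀ {n} → Fin n → Vec n
e a x = if does (a Fin.≟ x) then 1ᶜ else 0ᶜ

1ᴹ : ∀ {n} → Matrix n
1ᴹ a b = e a b

_^ᴹ_ : ∀ {n} → Matrix n → ℕ → Matrix n
X ^ᴹ zero  = 1ᴹ
X ^ᴹ suc n = X *ᴹ X ^ᴹ n

invFact : ℕ → ℚ
invFact j = (+ 1 / j !) {{j ℕ.!≢0}}

invFact-suc : ∀ j → invFact (suc j) ≡ unit j * invFact j
invFact-suc j = recip-* (suc j) (j !) {{_}} {{j ℕ.!≢0}} {{suc j ℕ.!≢0}}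

invFact-nonNeg : ∀ j → 0ℚ ≤ invFact j
invFact-nonNeg zero    = ℚ.<⇒≤ 0<1
invFact-nonNeg (suc j) = subst (0ℚ ≤_) (sym (invFact-suc j))
  (*-nonNeg (ℚ.<⇒≤ (unit-pos j)) (invFact-nonNeg j))

expTerm : ∀ {n} → Matrix n → Fin n → Fin n → ℕ → ℂ
expTerm X a b j = fromℚ (invFact j) ·ᶜ (X ^ᴹ j) a b

infix 4 ∣_∣ᶜ≲_

∣_∣ᶜ≲_ : ℂ → ℚ → Set
∣ z ∣ᶜ≲ q = ∣ re z ∣≲ q × ∣ im z ∣≲ q

≲-0ᴿ : ∀ {q} → 0ℚ ≤ q → ∣ 0ᴿ ∣≲ q
≲-0ᴿ 0≤q = ≲-weaken 0≤q (≲-fromℚ 0ℚ)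

≲-1ᴿ : ∀ {q} → 1ℚ ≤ q → ∣ 1ᴿ ∣≲ q
≲-1ᴿ 1≤q = ≲-weaken 1≤q (≲-fromℚ 1ℚ)

≲-0ᶜ : ∀ {q} → 0ℚ ≤ q → ∣ 0ᶜ ∣ᶜ≲ q
≲-0ᶜ 0≤q = ≲-0ᴿ 0≤q , ≲-0ᴿ 0≤q

≲-+ᶜ : ∀ {z w p q} → ∣ z ∣ᶜ≲ p → ∣ w ∣ᶜ≲ q → ∣ z +ᶜ w ∣ᶜ≲ (p + q)
≲-+ᶜ (a , b) (c , d) = ≲-+ a c , ≲-+ b d

≲-*ᶜ : ∀ {z w p q} → 0ℚ ≤ p → ∣ z ∣ᶜ≲ p → ∣ w ∣ᶜ≲ q → ∣ z *ᶜ w ∣ᶜ≲ (p * q + p * q)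
≲-*ᶜ 0≤p (a , b) (c , d) =
  ≲-+ (≲-* 0≤p a c) (≲-neg (≲-* 0≤p b d)) , ≲-+ (≲-* 0≤p a d) (≲-* 0≤p b c)

≲-sum : ∀ {n q} {f : Vec n} → (∀ x → ∣ f x ∣ᶜ≲ q) → ∣ sumᶜ f ∣ᶜ≲ (n ×ℚ q)
≲-sum {zero}  f≲q = ≲-0ᶜ ℚ.≤-refl
≲-sum {suc n} f≲q = ≲-+ᶜ (f≲q zero) (≲-sum (λ x → f≲q (suc x)))

uniform : ∀ {n} (P : Fin n → ℚ → Set) → (∀ {x p q} → p ≤ q → P x p → P x q) →
          (∀ x → ∃[ B ] 0ℚ < B × P x B) → ∃[ B ] 0ℚ < B × (∀ x → P x B)
uniform {zero}  P weaken bounds = 1ℚ , 0<1 , λ ()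
uniform {suc n} P weaken bounds =
  let A , 0<A , a = bounds zero
      B , 0<B , b = uniform (λ x → P (suc x)) weaken (λ x → bounds (suc x))
  in A + B , +-pos 0<A 0<B , λ where
       zero    → weaken (≤-weaken ℚ.≤-refl (ℚ.<⇒≤ 0<B)) a
       (suc x) → weaken (subst (_≤ A + B) (ℚ.+-identityˡ B) (ℚ.+-monoˡ-≤ B (ℚ.<⇒≤ 0<A))) (b x)

≲-weakenᶜ : ∀ {z p q} → p ≤ q → ∣ z ∣ᶜ≲ p → ∣ z ∣ᶜ≲ q
≲-weakenᶜ p≤q (a , b) = ≲-weaken p≤q a , ≲-weaken p≤q b

boundedᶜ : ∀ z → ∃[ B ] 0ℚ < B × ∣ z ∣ᶜ≲ B
boundedᶜ z =
  let A , 0<A , a = bounded (re z)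
      B , 0<B , b = bounded (im z)
  in A + B , +-pos 0<A 0<B ,
     ≲-weaken (≤-weaken ℚ.≤-refl (ℚ.<⇒≤ 0<B)) (mk≲ a) ,
     ≲-weaken (subst (_≤ A + B) (ℚ.+-identityˡ B) (ℚ.+-monoˡ-≤ B (ℚ.<⇒≤ 0<A))) (mk≲ b)

module ExpConvergence {n} (X : Matrix n) where
  open +-*-Solver

  entry-bound : ∃[ B ] 0ℚ < B × (∀ a b → ∣ X a b ∣ᶜ≲ B)
  entry-bound = uniform (λ a B → ∀ b → ∣ X a b ∣ᶜ≲ B) (λ p≤q h b → ≲-weakenᶜ p≤q (h b))
    λ a → uniform (λ b B → ∣ X a b ∣ᶜ≲ B) ≲-weakenᶜ λ b → boundedᶜ (X a b)

  B = proj₁ entry-bound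

  0<B : 0ℚ < B
  0<B = proj₁ (proj₂ entry-bound)

  C = suc n ×ℚ (B + B)

  ×-nonNeg : ∀ m {p} → 0ℚ ≤ p → 0ℚ ≤ m ×ℚ p
  ×-nonNeg zero    0≤p = ℚ.≤-refl
  ×-nonNeg (suc m) 0≤p = +-nonNeg 0≤p (×-nonNeg m 0≤p)

  ×-assoc-* : ∀ m p q → m ×ℚ (p * q + p * q) ≡ (m ×ℚ (p + p)) * q
  ×-assoc-* zero    p q = sym (ℚ.*-zeroˡ q)
  ×-assoc-* (suc m) p q = trans (cong (λ r → (p * q + p * q) + r) (×-assoc-* m p q))
    (lemma p q (m ×ℚ (p + p)))
    where
    lemma : ∀ p q r → (p * q + p * q) + r * q ≡ ((p + p) + r) * q
    lemma = solve 3 (λ p q r → (p :* q :+ p :* q) :+ r :* q := ((p :+ p) :+ r) :* q) refl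

  0<C : 0ℚ < C
  0<C = ℚ.+-mono-<-≤ (+-pos 0<B 0<B) (×-nonNeg n (ℚ.<⇒≤ (+-pos 0<B 0<B)))

  C^-nonNeg : ∀ j → 0ℚ ≤ C ^ℚ j
  C^-nonNeg zero    = ℚ.<⇒≤ 0<1
  C^-nonNeg (suc j) = *-nonNeg (ℚ.<⇒≤ 0<C) (C^-nonNeg j)

  power-bound : ∀ j a b → ∣ (X ^ᴹ j) a b ∣ᶜ≲ (C ^ℚ j)
  power-bound zero a b with does (a Fin.≟ b)
  ... | true  = ≲-1ᴿ ℚ.≤-refl , ≲-0ᴿ (ℚ.<⇒≤ 0<1)
  ... | false = ≲-0ᶜ (ℚ.<⇒≤ 0<1)
  power-bound (suc j) a b = ≲-weakenᶜ
    (widen (×-assoc-* (suc n) B D) (extra (n ×ℚ (B * D + B * D)) (B * D + B * D) (+-nonNeg 0≤BD 0≤BD)))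
    (≲-sum λ c → ≲-*ᶜ (ℚ.<⇒≤ 0<B) (proj₂ (proj₂ entry-bound) a c) (power-bound j c b))
    where
    D = C ^ℚ j
    0≤BD : 0ℚ ≤ B * D
    0≤BD = *-nonNeg (ℚ.<⇒≤ 0<B) (C^-nonNeg j)
    extra : ∀ p q → 0ℚ ≤ q → p ≤ q + p
    extra p q 0≤q = subst (_≤ q + p) (ℚ.+-identityˡ p) (ℚ.+-monoˡ-≤ p 0≤q)

  t : ℕ → ℚ
  t j = invFact j * C ^ℚ j

  0≤t : ∀ j → 0ℚ ≤ t j
  0≤t j = *-nonNeg (invFact-nonNeg j) (C^-nonNeg j)

  reciprocal = recip (+-pos 0<C 0<C)

  threshold : ∃[ N ] ∀ j → N ℕ.≤ j → unit j ≤ proj₁ reciprocal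
  threshold = unit-small (proj₁ reciprocal) (proj₁ (proj₂ reciprocal))

  halving : ∀ j → proj₁ threshold ℕ.≤ j → t (suc j) + t (suc j) ≤ t j
  halving j N≤j = subst (_≤ t j)
    (trans (lemma (unit j) C (invFact j) (C ^ℚ j))
      (cong (λ i → i * (C * C ^ℚ j) + i * (C * C ^ℚ j)) (sym (invFact-suc j))))
    (widen (trans (cong (_* t j) (proj₂ (proj₂ reciprocal))) (ℚ.*-identityˡ (t j)))
      (ℚ.*-monoʳ-≤-nonNeg (t j) {{nonNegative (0≤t j)}}
        (ℚ.*-monoʳ-≤-nonNeg (C + C) {{nonNegative (ℚ.<⇒≤ (+-pos 0<C 0<C))}}
          (proj₂ threshold j N≤j))))
    where
    lemma : ∀ u c i p → (u * (c + c)) * (i * p) ≡ (u * i) * (c * p) + (u * i) * (c * p)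
    lemma = solve 4 (λ u c i p →
      (u :* (c :+ c)) :* (i :* p) := (u :* i) :* (c :* p) :+ (u :* i) :* (c :* p)) refl

  term-bound : ∀ a b j → ∣ expTerm X a b j ∣ᶜ≲ t j
  term-bound a b j = scale (proj₁ (power-bound j a b)) , scale (proj₂ (power-bound j a b))
    where
    scale : ∀ {x} → ∣ x ∣≲ (C ^ℚ j) → ∣ fromℚ (invFact j) *ᴿ x ∣≲ t j
    scale = ≲-* (invFact-nonNeg j)
      (≲-weaken (ℚ.≤-reflexive (ℚ.0≤p⇒∣p∣≡p (invFact-nonNeg j))) (≲-fromℚ (invFact j)))

  module Re (a b : Fin n) = Comparison
    (λ j → re (partialSum (expTerm X a b) j)) (λ j → re (expTerm X a b j)) t
    (λ _ → refl) (λ j → proj₁ (term-bound a b j)) 0≤t (proj₁ threshold) halving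
  module Im (a b : Fin n) = Comparison
    (λ j → im (partialSum (expTerm X a b) j)) (λ j → im (expTerm X a b j)) t
    (λ _ → refl) (λ j → proj₂ (term-bound a b j)) 0≤t (proj₁ threshold) halving

abstract
  exp-converges : ∀ {n} (X : Matrix n) a b → Σ[ l ∈ ℂ ] partialSum (expTerm X a b) ⟶ᶜ l
  exp-converges X a b =
    let x , ⟶x = complete (λ j → re (partialSum (expTerm X a b) j)) (Re.partial-sums-cauchy a b)
        y , ⟶y = complete (λ j → im (partialSum (expTerm X a b) j)) (Im.partial-sums-cauchy a b)
    in x +i y , ⟶x , ⟶y
    where open ExpConvergence X

exp : ∀ {n} → Matrix n → Matrix n
exp X a b = proj₁ (exp-converges X a b)

-- The real part of exp (iθ), with iθ as a 1×1 matrix.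
cos : ℝ → ℝ
cos θ = re (exp {1} (λ _ _ → θ ·ᶜ 𝕚) zero zero)

record IsLeastPositiveZero (f : ℝ → ℝ) (x : ℝ) : Set where
  field
    x-pos    : 0ᴿ <ᴿ x
    is-zero  : f x ≈ᴿ 0ᴿ
    least    : ∀ y → 0ᴿ <ᴿ y → f y ≈ᴿ 0ᴿ → x ≤ᴿ y

-- The truncated cosine series c m has difference quotients bounded away from
-- 0 on [1,2], because differences of its terms alternate in sign and decrease;
-- hence approximate roots q m of c m, found by bisection, form a Cauchy
-- sequence.
module HalfPi where
  open +-*-Solver

  ⅓ ⅙ ¹/₁₂ 2ℚ 4ℚ : ℚ
  ⅓ = + 1 / 3
  ⅙ = + 1 / 6
  ¹/₁₂ = + 1 / 12
  2ℚ = + 2 / 1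
  4ℚ = + 4 / 1

  decide : ∀ p q {_ : T (p ≤ᵇ q)} → p ≤ q
  decide p q {t} = ℚ.≤ᵇ⇒≤ t

  0≤sub : ∀ {p q} → q ≤ p → 0ℚ ≤ p - q
  0≤sub {p} {q} q≤p = subst (_≤ p - q) (ℚ.+-inverseʳ q) (ℚ.+-monoˡ-≤ (- q) q≤p)

  sub-mono : ∀ p {q r} → q ≤ r → p - r ≤ p - q
  sub-mono p q≤r = ℚ.+-monoʳ-≤ p (ℚ.neg-antimono-≤ q≤r)

  sub-≤ : ∀ p {q} → 0ℚ ≤ q → p - q ≤ p
  sub-≤ p 0≤q = widen (ℚ.+-identityʳ p) (sub-mono p 0≤q)

  abs-≤ : ∀ p {q} → p ≤ q → - p ≤ q → ∣ p ∣ ≤ q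
  abs-≤ p {q} p≤q -p≤q = by (ℚ.∣p∣≡p∨∣p∣≡-p p)
    where
    by : ∣ p ∣ ≡ p ⊎ ∣ p ∣ ≡ - p → ∣ p ∣ ≤ q
    by (inj₁ eq) = subst (_≤ q) (sym eq) p≤q
    by (inj₂ eq) = subst (_≤ q) (sym eq) -p≤q

  ≤-abs : ∀ p → p ≤ ∣ p ∣
  ≤-abs p = by (ℚ.≤-total 0ℚ p)
    where
    by : 0ℚ ≤ p ⊎ p ≤ 0ℚ → p ≤ ∣ p ∣
    by (inj₁ 0≤p) = ℚ.≤-reflexive (sym (ℚ.0≤p⇒∣p∣≡p 0≤p))
    by (inj₂ p≤0) = ℚ.≤-trans p≤0 (ℚ.0≤∣p∣ p)

  unit-antitone : ∀ c n → unit (c ℕ.+ n) ≤ unit c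
  unit-antitone c n = ℚ.toℚᵘ-cancel-≤
    (ℚᵘ.≤-respˡ-≃ (ℚᵘ.≃-sym (ℚ.toℚᵘ-fromℚᵘ (mkℚᵘ (+ 1) (c ℕ.+ n))))
      (ℚᵘ.≤-respʳ-≃ (ℚᵘ.≃-sym (ℚ.toℚᵘ-fromℚᵘ (mkℚᵘ (+ 1) c)))
        (ℚᵘ.*≤* (ℤ.+≤+ (ℕ.*-monoʳ-≤ 1 (s≤s (ℕ.m≤m+n c n)))))))

  -- alt g m = g 0 - g 1 + ⋯ ± g (m - 1)
  alt : (ℕ → ℚ) → ℕ → ℚ
  alt g zero    = 0ℚ
  alt g (suc m) = g 0 - alt (λ j → g (suc j)) m

  sign : ℕ → ℚ
  sign zero    = 1ℚ
  sign (suc m) = - sign m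

  alt-bounds : ∀ g m → (∀ j → 0ℚ ≤ g j) → (∀ j → g (suc j) ≤ g j) →
               0ℚ ≤ alt g m × alt g m ≤ g 0
  alt-bounds g zero    0≤g dec = ℚ.≤-refl , 0≤g 0
  alt-bounds g (suc m) 0≤g dec =
    let lo , hi = alt-bounds (λ j → g (suc j)) m (λ j → 0≤g (suc j)) (λ j → dec (suc j))
    in 0≤sub (ℚ.≤-trans hi (dec 0)) , sub-≤ (g 0) lo

  alt-lower : ∀ g m → (∀ j → 0ℚ ≤ g j) → (∀ j → g (suc j) ≤ g j) →
              g 0 - g 1 ≤ alt g (suc m)
  alt-lower g m 0≤g dec = sub-mono (g 0)
    (proj₂ (alt-bounds (λ j → g (suc j)) m (λ j → 0≤g (suc j)) (λ j → dec (suc j))))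

  alt-sub : ∀ f g m → alt (λ j → f j - g j) m ≡ alt f m - alt g m
  alt-sub f g zero    = refl
  alt-sub f g (suc m) = trans
    (cong (λ a → (f 0 - g 0) - a) (alt-sub (λ j → f (suc j)) (λ j → g (suc j)) m))
    (lemma (f 0) (g 0) (alt (λ j → f (suc j)) m) (alt (λ j → g (suc j)) m))
    where
    lemma : ∀ p q r s → (p - q) - (r - s) ≡ (p - r) - (q - s)
    lemma = solve 4 (λ p q r s → (p :- q) :- (r :- s) := (p :- r) :- (q :- s)) refl

  alt-split : ∀ g m d → alt g (m ℕ.+ d) ≡ alt g m + sign m * alt (λ j → g (m ℕ.+ j)) d
  alt-split g zero    d = sym (trans (ℚ.+-identityˡ (1ℚ * alt g d)) (ℚ.*-identityˡ (alt g d)))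
  alt-split g (suc m) d = trans
    (cong (λ a → g 0 - a) (alt-split (λ j → g (suc j)) m d))
    (lemma (g 0) (alt (λ j → g (suc j)) m) (sign m) (alt (λ j → g (suc m ℕ.+ j)) d))
    where
    lemma : ∀ p q s r → p - (q + s * r) ≡ (p - q) + (- s) * r
    lemma = solve 4 (λ p q s r → p :- (q :+ s :* r) := (p :- q) :+ (:- s) :* r) refl

  alt-snoc : ∀ g m → alt g (suc m) ≡ alt g m + sign m * g m
  alt-snoc g zero    = lemma (g 0)
    where
    lemma : ∀ p → p - 0ℚ ≡ 0ℚ + 1ℚ * p
    lemma = solve 1 (λ p → p :- con 0ℚ := con 0ℚ :+ con 1ℚ :* p) refl
  alt-snoc g (suc m) = trans (cong (λ a → g 0 - a) (alt-snoc (λ j → g (suc j)) m))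
    (lemma (g 0) (alt (λ j → g (suc j)) m) (sign m) (g (suc m)))
    where
    lemma : ∀ p q s r → p - (q + s * r) ≡ (p - q) + (- s) * r
    lemma = solve 4 (λ p q s r → p :- (q :+ s :* r) := (p :- q) :+ (:- s) :* r) refl

  abs-sign : ∀ m → ∣ sign m ∣ ≡ 1ℚ
  abs-sign zero    = refl
  abs-sign (suc m) = trans (ℚ.∣-p∣≡∣p∣ (sign m)) (abs-sign m)

  alt-tail : ∀ g m d → (∀ j → 0ℚ ≤ g (m ℕ.+ j)) → (∀ j → g (m ℕ.+ suc j) ≤ g (m ℕ.+ j)) →
             ∣ alt g (m ℕ.+ d) - alt g m ∣ ≤ g (m ℕ.+ 0)
  alt-tail g m d 0≤g dec = subst (_≤ g (m ℕ.+ 0)) (sym eq) hi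
    where
    r = alt (λ j → g (m ℕ.+ j)) d
    lo = proj₁ (alt-bounds (λ j → g (m ℕ.+ j)) d 0≤g dec)
    hi = proj₂ (alt-bounds (λ j → g (m ℕ.+ j)) d 0≤g dec)
    lemma : ∀ a b → (a + b) - a ≡ b
    lemma = solve 2 (λ a b → (a :+ b) :- a := b) refl
    eq : ∣ alt g (m ℕ.+ d) - alt g m ∣ ≡ r
    eq = trans (cong (λ a → ∣ a - alt g m ∣) (alt-split g m d))
      (trans (cong ∣_∣ (lemma (alt g m) (sign m * r)))
        (trans (ℚ.∣p*q∣≡∣p∣*∣q∣ (sign m) r)
          (trans (cong₂ _*_ (abs-sign m) (ℚ.0≤p⇒∣p∣≡p lo)) (ℚ.*-identityˡ r))))

  double : ℕ → ℕ
  double zero    = zero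
  double (suc m) = suc (suc (double m))

  -- h (x * x) j = x²ʲ / (2j)!
  h : ℚ → ℕ → ℚ
  h u j = invFact (double j) * u ^ℚ j

  invFact-drop : ∀ j → invFact (double (2 ℕ.+ j)) ≤ ¹/₁₂ * invFact (double (1 ℕ.+ j))
  invFact-drop j = subst (_≤ ¹/₁₂ * I) (sym eq)
    (ℚ.*-monoʳ-≤-nonNeg I {{nonNegative (invFact-nonNeg k)}}
      (*-mono (ℚ.<⇒≤ (unit-pos 3)) (ℚ.<⇒≤ (unit-pos k))
        (unit-antitone 3 (double j)) (unit-antitone 2 (double j))))
    where
    k = double (1 ℕ.+ j)
    I = invFact k
    eq : invFact (double (2 ℕ.+ j)) ≡ (unit (suc k) * unit k) * I
    eq = trans (invFact-suc (suc k))
      (trans (cong (unit (suc k) *_) (invFact-suc k)) (sym (ℚ.*-assoc (unit (suc k)) (unit k) I)))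

  ^-nonNeg : ∀ {u} j → 0ℚ ≤ u → 0ℚ ≤ u ^ℚ j
  ^-nonNeg zero    0≤u = ℚ.<⇒≤ 0<1
  ^-nonNeg (suc j) 0≤u = *-nonNeg 0≤u (^-nonNeg j 0≤u)

  ^-mono : ∀ {u v} j → 0ℚ ≤ u → u ≤ v → u ^ℚ j ≤ v ^ℚ j
  ^-mono zero    0≤u u≤v = ℚ.≤-refl
  ^-mono (suc j) 0≤u u≤v = *-mono (ℚ.≤-trans 0≤u u≤v) (^-nonNeg j 0≤u) u≤v (^-mono j 0≤u u≤v)

  h-nonNeg : ∀ {u} j → 0ℚ ≤ u → 0ℚ ≤ h u j
  h-nonNeg j 0≤u = *-nonNeg (invFact-nonNeg (double j)) (^-nonNeg j 0≤u)

  h-mono : ∀ {u v} j → 0ℚ ≤ u → u ≤ v → h u j ≤ h v j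
  h-mono j 0≤u u≤v = ℚ.*-monoˡ-≤-nonNeg (invFact (double j))
    {{nonNegative (invFact-nonNeg (double j))}} (^-mono j 0≤u u≤v)

  h-drop : ∀ {u} j → 0ℚ ≤ u → u ≤ 4ℚ → h u (2 ℕ.+ j) ≤ ⅓ * h u (1 ℕ.+ j)
  h-drop {u} j 0≤u u≤4 = widen (lemma (invFact (double (1 ℕ.+ j))) (u ^ℚ (1 ℕ.+ j)))
    (*-mono (*-nonNeg (decide 0ℚ ¹/₁₂) (invFact-nonNeg (double (1 ℕ.+ j))))
      (^-nonNeg (2 ℕ.+ j) 0≤u) (invFact-drop j)
      (ℚ.*-monoʳ-≤-nonNeg (u ^ℚ (1 ℕ.+ j)) {{nonNegative (^-nonNeg (1 ℕ.+ j) 0≤u)}} u≤4))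
    where
    lemma : ∀ i p → (¹/₁₂ * i) * (4ℚ * p) ≡ ⅓ * (i * p)
    lemma = solve 2 (λ i p → (con ¹/₁₂ :* i) :* (con 4ℚ :* p) := con ⅓ :* (i :* p)) refl

  ≤-scale : ∀ {c p} → c ≤ 1ℚ → 0ℚ ≤ p → c * p ≤ p
  ≤-scale {c} {p} c≤1 0≤p = widen (ℚ.*-identityˡ p)
    (ℚ.*-monoʳ-≤-nonNeg p {{nonNegative 0≤p}} c≤1)

  h-dec : ∀ {u} j → 0ℚ ≤ u → u ≤ 4ℚ → h u (2 ℕ.+ j) ≤ h u (1 ℕ.+ j)
  h-dec j 0≤u u≤4 = ℚ.≤-trans (h-drop j 0≤u u≤4) (≤-scale (decide ⅓ 1ℚ) (h-nonNeg (1 ℕ.+ j) 0≤u))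

  h-halving : ∀ j → 1 ℕ.≤ j → h 4ℚ (suc j) + h 4ℚ (suc j) ≤ h 4ℚ j
  h-halving (suc j) (s≤s _) = ℚ.≤-trans (ℚ.+-mono-≤ drop drop)
    (subst (_≤ h 4ℚ (1 ℕ.+ j)) (lemma (h 4ℚ (1 ℕ.+ j)))
      (≤-scale (decide (⅓ + ⅓) 1ℚ) (h-nonNeg (1 ℕ.+ j) (decide 0ℚ 4ℚ))))
    where
    drop = h-drop j (decide 0ℚ 4ℚ) (ℚ.≤-refl {4ℚ})
    lemma : ∀ p → (⅓ + ⅓) * p ≡ ⅓ * p + ⅓ * p
    lemma = solve 1 (λ p → con (⅓ + ⅓) :* p := con ⅓ :* p :+ con ⅓ :* p) refl

  module Difference {u v} (0≤u : 0ℚ ≤ u) (u≤v : u ≤ v) (v≤4 : v ≤ 4ℚ) where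
    0≤v = ℚ.≤-trans 0≤u u≤v

    g : ℕ → ℚ
    g j = h v (suc j) - h u (suc j)

    d : ℕ → ℚ
    d j = v ^ℚ suc j - u ^ℚ suc j

    g≡ : ∀ j → g j ≡ invFact (double (suc j)) * d j
    g≡ j = lemma (invFact (double (suc j))) (v ^ℚ suc j) (u ^ℚ suc j)
      where
      lemma : ∀ i p q → i * p - i * q ≡ i * (p - q)
      lemma = solve 3 (λ i p q → i :* p :- i :* q := i :* (p :- q)) refl

    0≤d : ∀ j → 0ℚ ≤ d j
    0≤d j = 0≤sub (^-mono (suc j) 0≤u u≤v)

    0≤g : ∀ j → 0ℚ ≤ g j
    0≤g j = 0≤sub (h-mono (suc j) 0≤u u≤v)

    d-growth : ∀ j → d (suc j) ≤ (4ℚ + 4ℚ) * d j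
    d-growth j = ℚ.≤-trans
      (subst (_≤ v * d j + v * d j) (sym (lemma₁ v u (v ^ℚ suc j) (u ^ℚ suc j)))
        (ℚ.+-monoʳ-≤ (v * d j) (ℚ.≤-trans (subst (_≤ u * d j) (lemma₂ u v (u ^ℚ j)) inner)
          (ℚ.*-monoʳ-≤-nonNeg (d j) {{nonNegative (0≤d j)}} u≤v))))
      (subst (_≤ (4ℚ + 4ℚ) * d j) (ℚ.*-distribʳ-+ (d j) v v)
        (ℚ.*-monoʳ-≤-nonNeg (d j) {{nonNegative (0≤d j)}} (ℚ.+-mono-≤ v≤4 v≤4)))
      where
      lemma₁ : ∀ v u p q → v * p - u * q ≡ v * (p - q) + (v - u) * q
      lemma₁ = solve 4 (λ v u p q → v :* p :- u :* q := v :* (p :- q) :+ (v :- u) :* q) refl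
      lemma₂ : ∀ u v p → u * ((v - u) * p) ≡ (v - u) * (u * p)
      lemma₂ = solve 3 (λ u v p → u :* ((v :- u) :* p) := (v :- u) :* (u :* p)) refl
      lemma₃ : ∀ u v p → (v - u) * p ≡ v * p - u * p
      lemma₃ = solve 3 (λ u v p → (v :- u) :* p := v :* p :- u :* p) refl
      inner : u * ((v - u) * u ^ℚ j) ≤ u * d j
      inner = ℚ.*-monoˡ-≤-nonNeg u {{nonNegative 0≤u}}
        (subst (_≤ d j) (sym (lemma₃ u v (u ^ℚ j)))
          (ℚ.+-monoˡ-≤ (- (u * u ^ℚ j)) (ℚ.*-monoˡ-≤-nonNeg v {{nonNegative 0≤v}} (^-mono j 0≤u u≤v))))

    g-drop : ∀ j → g (suc j) ≤ (⅓ + ⅓) * g j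
    g-drop j = subst₂ _≤_ (sym (g≡ (suc j)))
      (trans (lemma (invFact (double (suc j))) (d j)) (cong ((⅓ + ⅓) *_) (sym (g≡ j))))
      (*-mono (*-nonNeg (decide 0ℚ ¹/₁₂) (invFact-nonNeg (double (suc j)))) (0≤d (suc j))
        (invFact-drop j) (d-growth j))
      where
      lemma : ∀ i p → (¹/₁₂ * i) * ((4ℚ + 4ℚ) * p) ≡ (⅓ + ⅓) * (i * p)
      lemma = solve 2 (λ i p → (con ¹/₁₂ :* i) :* (con (4ℚ + 4ℚ) :* p) := con (⅓ + ⅓) :* (i :* p)) refl

    g-dec : ∀ j → g (suc j) ≤ g j
    g-dec j = ℚ.≤-trans (g-drop j) (≤-scale (decide (⅓ + ⅓) 1ℚ) (0≤g j))

    g₀ : g 0 ≡ ½ * (v - u)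
    g₀ = lemma v u
      where
      lemma : ∀ v u → ½ * (v * 1ℚ) - ½ * (u * 1ℚ) ≡ ½ * (v - u)
      lemma = solve 2 (λ v u → con ½ :* (v :* con 1ℚ) :- con ½ :* (u :* con 1ℚ) := con ½ :* (v :- u)) refl

    difference : ∀ m → alt (h u) (3 ℕ.+ m) - alt (h v) (3 ℕ.+ m) ≡ alt g (2 ℕ.+ m)
    difference m = trans (lemma (h u 0) (alt (λ j → h u (suc j)) (2 ℕ.+ m)) (alt (λ j → h v (suc j)) (2 ℕ.+ m)))
      (sym (alt-sub (λ j → h v (suc j)) (λ j → h u (suc j)) (2 ℕ.+ m)))
      where
      lemma : ∀ p q r → (p - q) - (p - r) ≡ r - q
      lemma = solve 3 (λ p q r → (p :- q) :- (p :- r) := r :- q) refl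

    upper : ∀ m → alt (h u) (3 ℕ.+ m) - alt (h v) (3 ℕ.+ m) ≤ ½ * (v - u)
    upper m = subst₂ _≤_ (sym (difference m)) g₀ (proj₂ (alt-bounds g (2 ℕ.+ m) 0≤g g-dec))

    lower : ∀ m → ⅙ * (v - u) ≤ alt (h u) (3 ℕ.+ m) - alt (h v) (3 ℕ.+ m)
    lower m = subst₂ _≤_ (trans (cong (λ p → p - (⅓ + ⅓) * p) g₀) (lemma (v - u))) (sym (difference m))
      (ℚ.≤-trans (sub-mono (g 0) (g-drop 0)) (alt-lower g (suc m) 0≤g g-dec))
      where
      lemma : ∀ p → ½ * p - (⅓ + ⅓) * (½ * p) ≡ ⅙ * p
      lemma = solve 1 (λ p → con ½ :* p :- con (⅓ + ⅓) :* (con ½ :* p) := con ⅙ :* p) refl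

  c : ℕ → ℚ → ℚ
  c m x = alt (h (x * x)) (3 ℕ.+ m)

  0≤² : ∀ {x} → 0ℚ ≤ x → 0ℚ ≤ x * x
  0≤² 0≤x = *-nonNeg 0≤x 0≤x

  ²-mono : ∀ {x y} → 0ℚ ≤ x → x ≤ y → x * x ≤ y * y
  ²-mono 0≤x x≤y = *-mono (ℚ.≤-trans 0≤x x≤y) 0≤x x≤y x≤y

  ²≤4 : ∀ {x} → 0ℚ ≤ x → x ≤ 2ℚ → x * x ≤ 4ℚ
  ²≤4 0≤x x≤2 = ²-mono 0≤x x≤2

  factor : ∀ x y → (y + x) * (y - x) ≡ y * y - x * x
  factor = solve 2 (λ x y → (y :+ x) :* (y :- x) := y :* y :- x :* x) refl

  c-upper : ∀ m {x y} → 0ℚ ≤ x → x ≤ y → y ≤ 2ℚ → c m x - c m y ≤ 2ℚ * (y - x)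
  c-upper m {x} {y} 0≤x x≤y y≤2 = ℚ.≤-trans
    (Difference.upper (0≤² 0≤x) (²-mono 0≤x x≤y) (²≤4 0≤y y≤2) m)
    (subst₂ _≤_ (cong (½ *_) (factor x y)) (lemma (y - x))
      (ℚ.*-monoˡ-≤-nonNeg ½ (ℚ.*-monoʳ-≤-nonNeg (y - x) {{nonNegative (0≤sub x≤y)}}
        (ℚ.+-mono-≤ y≤2 (ℚ.≤-trans x≤y y≤2)))))
    where
    0≤y = ℚ.≤-trans 0≤x x≤y
    lemma : ∀ d → ½ * ((2ℚ + 2ℚ) * d) ≡ 2ℚ * d
    lemma = solve 1 (λ d → con ½ :* (con (2ℚ + 2ℚ) :* d) := con 2ℚ :* d) refl

  c-lower : ∀ m {x y} → 0ℚ ≤ x → x ≤ y → 1ℚ ≤ y → y ≤ 2ℚ → ⅙ * (y - x) ≤ c m x - c m y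
  c-lower m {x} {y} 0≤x x≤y 1≤y y≤2 = ℚ.≤-trans
    (ℚ.*-monoˡ-≤-nonNeg ⅙ (subst₂ _≤_ (ℚ.*-identityˡ (y - x)) (factor x y)
      (ℚ.*-monoʳ-≤-nonNeg (y - x) {{nonNegative (0≤sub x≤y)}} (≤-weaken 1≤y 0≤x))))
    (Difference.lower (0≤² 0≤x) (²-mono 0≤x x≤y) (²≤4 (ℚ.≤-trans 0≤x x≤y) y≤2) m)

  0≤c1 : ∀ m → 0ℚ ≤ c m 1ℚ
  0≤c1 m = ℚ.≤-trans (decide 0ℚ (h 1ℚ 0 - h 1ℚ 1)) (sub-mono (h 1ℚ 0)
    (proj₂ (alt-bounds (λ j → h 1ℚ (suc j)) (2 ℕ.+ m)
      (λ j → h-nonNeg (suc j) (decide 0ℚ 1ℚ)) (λ j → h-dec j (decide 0ℚ 1ℚ) (decide 1ℚ 4ℚ)))))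

  c2≤0 : ∀ m → c m 2ℚ ≤ 0ℚ
  c2≤0 m = ℚ.≤-trans
    (sub-mono (h 4ℚ 0)
      (alt-lower (λ j → h 4ℚ (suc j)) (suc m)
        (λ j → h-nonNeg (suc j) (decide 0ℚ 4ℚ)) (λ j → h-dec j (decide 0ℚ 4ℚ) ℚ.≤-refl)))
    (decide (h 4ℚ 0 - (h 4ℚ 1 - h 4ℚ 2)) 0ℚ)

  c-tail : ∀ m n {x} → m ℕ.≤ n → 0ℚ ≤ x → x ≤ 2ℚ → ∣ c m x - c n x ∣ ≤ h 4ℚ (3 ℕ.+ m)
  c-tail m n {x} m≤n 0≤x x≤2 = subst (λ k → ∣ c m x - c k x ∣ ≤ h 4ℚ (3 ℕ.+ m)) (ℕ.m+[n∸m]≡n m≤n)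
    (subst (_≤ h 4ℚ (3 ℕ.+ m)) (abs-sub-comm (c (m ℕ.+ (n ℕ.∸ m)) x) (c m x))
      (ℚ.≤-trans
        (alt-tail (h (x * x)) (3 ℕ.+ m) (n ℕ.∸ m)
          (λ j → h-nonNeg (3 ℕ.+ m ℕ.+ j) (0≤² 0≤x))
          (λ j → subst (λ k → h (x * x) (3 ℕ.+ k) ≤ h (x * x) (3 ℕ.+ m ℕ.+ j)) (sym (ℕ.+-suc m j))
            (h-dec (2 ℕ.+ m ℕ.+ j) (0≤² 0≤x) (²≤4 0≤x x≤2))))
        (subst (λ k → h (x * x) (3 ℕ.+ k) ≤ h 4ℚ (3 ℕ.+ m)) (sym (ℕ.+-identityʳ m))
          (h-mono (3 ℕ.+ m) (0≤² 0≤x) (²≤4 0≤x x≤2)))))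

  record Bracket (f : ℚ → ℚ) (w : ℚ) : Set where
    field
      left right : ℚ
      1≤left     : 1ℚ ≤ left
      left≤right : left ≤ right
      right≤2    : right ≤ 2ℚ
      0≤f-left   : 0ℚ ≤ f left
      f-right≤0  : f right ≤ 0ℚ
      width      : right - left ≡ w

  open Bracket

  bisect : ∀ {f w} → Bracket f w → Bracket f (½ * w)
  bisect {f} {w} b = choose (ℚ.≤-total 0ℚ (f mid))
    where
    mid = (left b + right b) * ½
    l≤mid : left b ≤ mid
    l≤mid = subst (_≤ mid) (lemma (left b)) (ℚ.*-monoʳ-≤-nonNeg ½ (ℚ.+-monoʳ-≤ (left b) (left≤right b)))
      where
      lemma : ∀ p → (p + p) * ½ ≡ p
      lemma = solve 1 (λ p → (p :+ p) :* con ½ := p) refl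
    mid≤r : mid ≤ right b
    mid≤r = widen (lemma (right b)) (ℚ.*-monoʳ-≤-nonNeg ½ (ℚ.+-monoˡ-≤ (right b) (left≤right b)))
      where
      lemma : ∀ p → (p + p) * ½ ≡ p
      lemma = solve 1 (λ p → (p :+ p) :* con ½ := p) refl
    choose : 0ℚ ≤ f mid ⊎ f mid ≤ 0ℚ → Bracket f (½ * w)
    choose (inj₁ 0≤f) = record
      { left = mid ; right = right b
      ; 1≤left = ℚ.≤-trans (1≤left b) l≤mid ; left≤right = mid≤r ; right≤2 = right≤2 b
      ; 0≤f-left = 0≤f ; f-right≤0 = f-right≤0 b
      ; width = trans (lemma (left b) (right b)) (cong (½ *_) (width b)) }
      where
      lemma : ∀ l r → r - (l + r) * ½ ≡ ½ * (r - l)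
      lemma = solve 2 (λ l r → r :- (l :+ r) :* con ½ := con ½ :* (r :- l)) refl
    choose (inj₂ f≤0) = record
      { left = left b ; right = mid
      ; 1≤left = 1≤left b ; left≤right = l≤mid ; right≤2 = ℚ.≤-trans mid≤r (right≤2 b)
      ; 0≤f-left = 0≤f-left b ; f-right≤0 = f≤0
      ; width = trans (lemma (left b) (right b)) (cong (½ *_) (width b)) }
      where
      lemma : ∀ l r → (l + r) * ½ - l ≡ ½ * (r - l)
      lemma = solve 2 (λ l r → (l :+ r) :* con ½ :- l := con ½ :* (r :- l)) refl

  bracket : ∀ m k → Bracket (c m) (½ ^ℚ k)
  bracket m zero = record
    { left = 1ℚ ; right = 2ℚ ; 1≤left = ℚ.≤-refl ; left≤right = decide 1ℚ 2ℚ ; right≤2 = ℚ.≤-refl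
    ; 0≤f-left = 0≤c1 m ; f-right≤0 = c2≤0 m ; width = refl }
  bracket m (suc k) = bisect (bracket m k)

  q : ℕ → ℚ
  q n = left (bracket n n)

  1≤q : ∀ n → 1ℚ ≤ q n
  1≤q n = 1≤left (bracket n n)

  0≤q : ∀ n → 0ℚ ≤ q n
  0≤q n = ℚ.≤-trans (decide 0ℚ 1ℚ) (1≤q n)

  q≤2 : ∀ n → q n ≤ 2ℚ
  q≤2 n = ℚ.≤-trans (left≤right (bracket n n)) (right≤2 (bracket n n))

  c-q : ∀ n → ∣ c n (q n) ∣ ≤ 2ℚ * ½ ^ℚ n
  c-q n = subst (_≤ 2ℚ * ½ ^ℚ n) (sym (ℚ.0≤p⇒∣p∣≡p (0≤f-left b)))
    (ℚ.≤-trans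
      (subst (_≤ c n (left b) - c n (right b)) (ℚ.+-identityʳ (c n (left b)))
        (sub-mono (c n (left b)) (f-right≤0 b)))
      (widen (cong (2ℚ *_) (width b)) (c-upper n (0≤q n) (left≤right b) (right≤2 b))))
    where b = bracket n n

  error-small : ∀ δ → 0ℚ < δ → Eventually λ n → 2ℚ * ½ ^ℚ n ≤ δ × h 4ℚ (3 ℕ.+ n) ≤ δ
  error-small δ 0<δ = both (λ _ → _,_) (½Decay.vanish δ 0<δ)
    (let N , small = hDecay.vanish δ 0<δ
     in N , λ n N≤n → small (3 ℕ.+ n) (ℕ.≤-trans N≤n (ℕ.m≤n+m n 3)))
    where
    halve : ∀ p → 2ℚ * (½ * p) + 2ℚ * (½ * p) ≡ 2ℚ * p
    halve = solve 1 (λ p → con 2ℚ :* (con ½ :* p) :+ con 2ℚ :* (con ½ :* p) := con 2ℚ :* p) refl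
    module ½Decay = Decay (λ n → 2ℚ * ½ ^ℚ n)
      (λ n → *-nonNeg (decide 0ℚ 2ℚ) (^-nonNeg n (decide 0ℚ ½)))
      0 (λ n _ → ℚ.≤-reflexive (halve (½ ^ℚ n)))
    module hDecay = Decay (h 4ℚ) (λ n → h-nonNeg n (decide 0ℚ 4ℚ)) 1 h-halving

  separation : ∀ m {x y} → 1ℚ ≤ x → x ≤ 2ℚ → 1ℚ ≤ y → y ≤ 2ℚ →
               ⅙ * ∣ x - y ∣ ≤ ∣ c m x - c m y ∣
  separation m {x} {y} 1≤x x≤2 1≤y y≤2 = by (ℚ.≤-total x y)
    where
    ordered : ∀ {x y} → 1ℚ ≤ x → x ≤ y → y ≤ 2ℚ → ⅙ * ∣ x - y ∣ ≤ ∣ c m x - c m y ∣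
    ordered {x} {y} 1≤x x≤y y≤2 = subst (λ d → ⅙ * d ≤ ∣ c m x - c m y ∣)
      (trans (sym (ℚ.0≤p⇒∣p∣≡p (0≤sub x≤y))) (abs-sub-comm y x))
      (ℚ.≤-trans (c-lower m (ℚ.≤-trans (decide 0ℚ 1ℚ) 1≤x) x≤y (ℚ.≤-trans 1≤x x≤y) y≤2)
        (≤-abs (c m x - c m y)))
    by : x ≤ y ⊎ y ≤ x → ⅙ * ∣ x - y ∣ ≤ ∣ c m x - c m y ∣
    by (inj₁ x≤y) = ordered 1≤x x≤y y≤2
    by (inj₂ y≤x) = subst₂ (λ d e → ⅙ * d ≤ e) (abs-sub-comm y x) (abs-sub-comm (c m y) (c m x))
      (ordered 1≤y y≤x x≤2)

  q-cauchy : IsCauchy q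
  q-cauchy ε 0<ε = N , close
    where
    ¹/₂₄ = + 1 / 24
    δ = ε * ¹/₂₄
    0<δ : 0ℚ < δ
    0<δ = *-pos 0<ε (ℚ.positive⁻¹ ¹/₂₄)
    N = proj₁ (error-small δ 0<δ)
    small = proj₂ (error-small δ 0<δ)
    near-zero : ∀ n → N ℕ.≤ n → ∣ c N (q n) ∣ ≤ δ + δ
    near-zero n N≤n = ℚ.≤-trans (abs-bound (c N (q n)) (c n (q n)))
      (ℚ.+-mono-≤
        (ℚ.≤-trans (c-tail N n N≤n (0≤q n) (q≤2 n)) (proj₂ (small N ℕ.≤-refl)))
        (ℚ.≤-trans (c-q n) (proj₁ (small n N≤n))))
    close : ∀ m n → N ℕ.≤ m → N ℕ.≤ n → ∣ q m - q n ∣ ≤ ε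
    close m n N≤m N≤n = ℚ.*-cancelˡ-≤-pos ⅙ (ℚ.≤-trans
      (separation N (1≤q m) (q≤2 m) (1≤q n) (q≤2 n))
      (ℚ.≤-trans (ℚ.∣p-q∣≤∣p∣+∣q∣ (c N (q m)) (c N (q n)))
        (widen (lemma ε) (ℚ.+-mono-≤ (near-zero m N≤m) (near-zero n N≤n)))))
      where
      lemma : ∀ ε → (ε * ¹/₂₄ + ε * ¹/₂₄) + (ε * ¹/₂₄ + ε * ¹/₂₄) ≡ ⅙ * ε
      lemma = solve 1 (λ ε → (ε :* con ¹/₂₄ :+ ε :* con ¹/₂₄) :+ (ε :* con ¹/₂₄ :+ ε :* con ¹/₂₄)
        := con ⅙ :* ε) refl

  halfPi : ℝ
  halfPi = mkℝ q q-cauchy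

  module Series (θ : ℝ) where
    X : Matrix 1
    X _ _ = θ ·ᶜ 𝕚

    s : ℕ → ℂ
    s = partialSum (expTerm X zero zero)

    module _ (n : ℕ) where
      x = approx θ n
      u = x * x

      reP imP : ℕ → ℚ
      reP j = approx (re ((X ^ᴹ j) zero zero)) n
      imP j = approx (im ((X ^ᴹ j) zero zero)) n

      re-step : ∀ j → reP (suc j) ≡ - (x * imP j)
      re-step j = lemma x (reP j) (imP j)
        where
        lemma : ∀ x r i → ((x * 0ℚ) * r + - ((x * 1ℚ) * i)) + 0ℚ ≡ - (x * i)
        lemma = solve 3 (λ x r i → ((x :* con 0ℚ) :* r :+ :- ((x :* con 1ℚ) :* i)) :+ con 0ℚ := :- (x :* i)) refl

      im-step : ∀ j → imP (suc j) ≡ x * reP j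
      im-step j = lemma x (reP j) (imP j)
        where
        lemma : ∀ x r i → ((x * 0ℚ) * i + (x * 1ℚ) * r) + 0ℚ ≡ x * r
        lemma = solve 3 (λ x r i → ((x :* con 0ℚ) :* i :+ (x :* con 1ℚ) :* r) :+ con 0ℚ := x :* r) refl

      re-even : ∀ m → reP (double m) ≡ sign m * u ^ℚ m
      re-even zero    = refl
      re-even (suc m) = trans (re-step (suc (double m)))
        (trans (cong (λ r → - (x * r)) (trans (im-step (double m)) (cong (x *_) (re-even m))))
          (lemma x (sign m) (u ^ℚ m)))
        where
        lemma : ∀ x s p → - (x * (x * (s * p))) ≡ (- s) * ((x * x) * p)
        lemma = solve 3 (λ x s p → :- (x :* (x :* (s :* p))) := (:- s) :* ((x :* x) :* p)) refl

      im-even : ∀ m → imP (double m) ≡ 0ℚ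
      im-even zero    = refl
      im-even (suc m) = trans (im-step (suc (double m)))
        (trans (cong (x *_) (trans (re-step (double m)) (cong (λ i → - (x * i)) (im-even m))))
          (lemma x))
        where
        lemma : ∀ x → x * (- (x * 0ℚ)) ≡ 0ℚ
        lemma = solve 1 (λ x → x :* (:- (x :* con 0ℚ)) := con 0ℚ) refl

      re-odd : ∀ m → reP (suc (double m)) ≡ 0ℚ
      re-odd m = trans (re-step (double m)) (trans (cong (λ i → - (x * i)) (im-even m)) (lemma x))
        where
        lemma : ∀ x → - (x * 0ℚ) ≡ 0ℚ
        lemma = solve 1 (λ x → :- (x :* con 0ℚ) := con 0ℚ) refl

      re-s : ∀ m → approx (re (s (double m))) n ≡ alt (h u) m
      re-s zero    = refl
      re-s (suc m) = trans
        (cong₂ (λ r t → r + I * t) (cong₂ (λ r t → r + J * t) (re-s m) (re-even m)) (re-odd m))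
        (trans (lemma (alt (h u) m) J (sign m) (u ^ℚ m) I) (sym (alt-snoc (h u) m)))
        where
        J = invFact (double m)
        I = invFact (suc (double m))
        lemma : ∀ a j s p i → (a + j * (s * p)) + i * 0ℚ ≡ a + s * (j * p)
        lemma = solve 5 (λ a j s p i → (a :+ j :* (s :* p)) :+ i :* con 0ℚ := a :+ s :* (j :* p)) refl

    ≤double : ∀ m → m ℕ.≤ double m
    ≤double zero    = z≤n
    ≤double (suc m) = s≤s (ℕ.m≤n⇒m≤1+n (≤double m))

    cos-approx : ∀ ε → 0ℚ < ε → ∃[ N ] ∀ m → N ℕ.≤ m →
                 Eventually λ n → ∣ c m (approx θ n) - approx (cos θ) n ∣ ≤ ε
    cos-approx ε 0<ε =
      let N , close = proj₁ (proj₂ (exp-converges X zero zero)) (ε * ½) (half-pos 0<ε)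
      in N , λ m N≤m →
        let M , p = close (double (3 ℕ.+ m))
                      (ℕ.≤-trans N≤m (ℕ.≤-trans (ℕ.m≤n+m m 3) (≤double (3 ℕ.+ m))))
                      (ε * ½) (half-pos 0<ε)
        in M , λ n M≤n → subst (λ r → ∣ r - approx (cos θ) n ∣ ≤ ε) (re-s n (3 ℕ.+ m))
             (widen (half+half ε) (p n M≤n))

    root-approx : cos θ ≈ᴿ 0ᴿ → ∀ ε → 0ℚ < ε → ∃[ N ] ∀ m → N ℕ.≤ m →
                  Eventually λ n → ∣ c m (approx θ n) ∣ ≤ ε
    root-approx cosθ≈0 ε 0<ε =
      let N , close = cos-approx (ε * ½) (half-pos 0<ε)
      in N , λ m N≤m → both
        (λ n p r → widen (half+half ε) (ℚ.≤-trans (abs-bound (c m (approx θ n)) (approx (cos θ) n))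
          (ℚ.+-mono-≤ p (subst (λ a → ∣ a ∣ ≤ ε * ½) (ℚ.+-identityʳ (approx (cos θ) n)) r))))
        (close m N≤m) (cosθ≈0 (ε * ½) (half-pos 0<ε))

  cos-halfPi : cos halfPi ≈ᴿ 0ᴿ
  cos-halfPi ε 0<ε =
    let N , close = Series.cos-approx halfPi δ 0<δ
        K , small = error-small δ 0<δ
        m = N ℕ.⊔ K
        M , p = close m (ℕ.m≤m⊔n N K)
    in M ℕ.⊔ m , λ n ≤n →
      let m≤n = ℕ.m⊔n≤o⇒n≤o M m ≤n
          K≤m = ℕ.m≤n⊔m N K
      in bound n m (p n (ℕ.m⊔n≤o⇒m≤o M m ≤n))
           (ℚ.≤-trans (c-tail m n m≤n (0≤q n) (q≤2 n)) (proj₂ (small m K≤m)))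
           (ℚ.≤-trans (c-q n) (proj₁ (small n (ℕ.≤-trans K≤m m≤n))))
    where
    δ = ε * ⅓
    0<δ : 0ℚ < δ
    0<δ = *-pos 0<ε (ℚ.positive⁻¹ ⅓)
    bound : ∀ n m → ∣ c m (q n) - approx (cos halfPi) n ∣ ≤ δ → ∣ c m (q n) - c n (q n) ∣ ≤ δ →
            ∣ c n (q n) ∣ ≤ δ → ∣ approx (cos halfPi) n - 0ℚ ∣ ≤ ε
    bound n m a b d = subst (λ r → ∣ r ∣ ≤ ε) (sym (ℚ.+-identityʳ z))
      (ℚ.≤-trans (abs-bound z (c m (q n)))
        (widen (lemma ε) (ℚ.+-mono-≤ (subst (_≤ δ) (abs-sub-comm (c m (q n)) z) a)
          (ℚ.≤-trans (abs-bound (c m (q n)) (c n (q n))) (ℚ.+-mono-≤ b d)))))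
      where
      z = approx (cos halfPi) n
      lemma : ∀ ε → ε * ⅓ + (ε * ⅓ + ε * ⅓) ≡ ε
      lemma = solve 1 (λ ε → ε :* con ⅓ :+ (ε :* con ⅓ :+ ε :* con ⅓) := ε) refl

  halfPi-pos : 0ᴿ <ᴿ halfPi
  halfPi-pos = 1ℚ , 0<1 , 0 , λ n _ → 1≤q n

  halfPi-least : ∀ y → 0ᴿ <ᴿ y → cos y ≈ᴿ 0ᴿ → halfPi ≤ᴿ y
  halfPi-least y (η , 0<η , 0<y) cos-y≈0 ε 0<ε =
    let M , a = Series.root-approx y cos-y≈0 δ 0<δ
        N , b = Series.root-approx halfPi cos-halfPi δ 0<δ
        m = M ℕ.⊔ N
    in both (λ n 0<y → λ (p , r) → compare m n (ℚ.≤-trans (≤-weaken (ℚ.≤-refl {0ℚ}) (ℚ.<⇒≤ 0<η)) 0<y) p r (ℚ.≤-total (q n) (approx y n)))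
         0<y (both (λ _ → _,_) (a m (ℕ.m≤m⊔n M N)) (b m (ℕ.m≤n⊔m M N)))
    where
    δ = ε * ¹/₁₂
    0<δ : 0ℚ < δ
    0<δ = *-pos 0<ε (ℚ.positive⁻¹ ¹/₁₂)
    compare : ∀ m n → 0ℚ ≤ approx y n → ∣ c m (approx y n) ∣ ≤ δ → ∣ c m (q n) ∣ ≤ δ →
              q n ≤ approx y n ⊎ approx y n ≤ q n → q n ≤ approx y n + ε
    compare m n 0≤y p r (inj₁ q≤y) = ≤-weaken q≤y (ℚ.<⇒≤ 0<ε)
    compare m n 0≤y p r (inj₂ y≤q) = subst (_≤ approx y n + ε) (shift (q n) (approx y n))
      (ℚ.+-monoʳ-≤ (approx y n) (ℚ.*-cancelˡ-≤-pos ⅙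
        (ℚ.≤-trans (c-lower m 0≤y y≤q (1≤q n) (q≤2 n))
          (ℚ.≤-trans (≤-abs (c m (approx y n) - c m (q n)))
            (ℚ.≤-trans (ℚ.∣p-q∣≤∣p∣+∣q∣ (c m (approx y n)) (c m (q n)))
              (widen (lemma ε) (ℚ.+-mono-≤ p r)))))))
      where
      shift : ∀ a b → b + (a - b) ≡ a
      shift = solve 2 (λ a b → b :+ (a :- b) := a) refl
      lemma : ∀ ε → ε * ¹/₁₂ + ε * ¹/₁₂ ≡ ⅙ * ε
      lemma = solve 1 (λ ε → ε :* con ¹/₁₂ :+ ε :* con ¹/₁₂ := con ⅙ :* ε) refl

abstract
  cos-least-zero : Σ[ x ∈ ℝ ] IsLeastPositiveZero cos x
  cos-least-zero = HalfPi.halfPi , record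
    { x-pos = HalfPi.halfPi-pos ; is-zero = HalfPi.cos-halfPi ; least = HalfPi.halfPi-least }

-- π is twice the least positive zero of the cosine.
π/2 : ℝ
π/2 = proj₁ cos-least-zero

record Graph : Set where
  field
    order  : ℕ
    adj    : Fin order → Fin order → Bool
    symm   : ∀ u v → adj u v ≡ adj v u
    irrefl : ∀ v → adj v v ≡ false

  Vertex : Set
  Vertex = Fin order

  valency : Vertex → ℕ
  valency v = Subset.∣ tabulate (adj v) ∣

  Connected : Set
  Connected = ∀ u v → Star (λ x y → adj x y ≡ true) u v

  Regular : Set
  Regular = ∃[ d ] ∀ v → valency v ≡ d

  MaxValency : ℕ → Set
  MaxValency k = (∀ v → valency v ℕ.≤ k) × ∃[ v ] valency v ≡ k

  A Δ L Q : Matrix order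
  A u v = if adj u v then 1ᶜ else 0ᶜ
  Δ u v = if does (u Fin.≟ v) then fromℕ (valency u) else 0ᶜ
  L = Δ -ᴹ A
  Q = Δ +ᴹ A

record _≅_ (G H : Graph) : Set where
  private
    module G = Graph G
    module H = Graph H
  field
    vertices : G.Vertex ↔ H.Vertex
    adj-cong : ∀ u v → H.adj (Inverse.to vertices u) (Inverse.to vertices v) ≡ G.adj u v

pair : ∀ {n} → Fin n → Fin n → Vec n
pair a b = e a -ᵛ e b

record PairStateTransfer {n} (M : Matrix n) (τ : ℝ) (a b c d : Fin n) : Set where
  field
    a≢b      : a ≢ b
    c≢d      : c ≢ d
    distinct : ¬ pair c d ≈ᵛ pair a b
    opposite : ¬ pair c d ≈ᵛ -ᵛ pair a b
    transfer : ∃[ γ ] exp ((τ ·ᶜ 𝕚) ·ᴹ M) *ᵛ pair a b ≈ᵛ γ ·ᵛ pair c d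

-- Let a, b, c, d be vertices of valency 2 with a ~ c and b ~ d, such that the
-- remaining neighbours of a and b coincide, and those of c and d as well. Then
-- A interchanges v = e a - e b and w = e c - e d, while Δ acts on both as 2, so
-- A, L and Q all act on their span as D + sσ with s = ±1, where σ swaps v and w.
-- Hence exp (iθM) v = exp (iDθ) (cos θ · v + is sin θ · w), which is a multiple
-- of w when cos θ = 0, in particular at θ = π/2.
--
-- In the butterfly (two triangles with a common vertex) the four vertices other
-- than the centre have this property, and it survives any enlargement of the
-- graph that adds no edge at them. Leaves at the centre raise its valency from
-- 4 to k, and a path growing from the last leaf gives infinitely many graphs.
module Submission where

open import Defs
open import Algebra.Bundles using (CommutativeRing)
open import Data.Bool.Base using (Bool; true; false; if_then_else_)
import Data.Bool.Properties as Bool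
open import Data.Fin.Base using (Fin; zero; suc)
open import Data.Fin.Patterns using (0F; 1F; 2F; 3F; 4F; 5F)
open import Data.Fin.Permutation using (↔⇒≡)
import Data.Fin.Properties as Fin
import Data.Fin.Subset as Subset
import Data.Integer.Base as ℤ
import Data.Integer.Properties as ℤ
import Data.Nat.Base as ℕ
open import Data.Nat.Base using (ℕ; zero; suc; _≤_)
import Data.Nat.Properties as ℕ
open import Data.Product.Base using (Σ-syntax; ∃-syntax; _×_; _,_; proj₁; proj₂)
open import Data.Rational.Base as ℚ
  using (ℚ; 0ℚ; 1ℚ; ½; _+_; _*_; -_; _-_; _/_; ∣_∣; nonNegative; +-*-rawSemiring)
import Data.Rational.Properties as ℚ
open import Data.Rational.Solver using (module +-*-Solver)
open import Data.Rational.Unnormalised.Base using (mkℚᵘ)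
import Data.Rational.Unnormalised.Base as ℚᵘ
import Data.Rational.Unnormalised.Properties as ℚᵘ
open import Data.Vec.Base using (tabulate)
open import Relation.Binary.Construct.Closure.ReflexiveTransitive
  using (Star; _◅_; _◅◅_; gmap; reverse)
open import Relation.Binary.PropositionalEquality
open import Relation.Nullary.Decidable.Core using (yes; no; does; toWitness)
open import Relation.Nullary.Negation.Core using (¬_; contradiction)
open import Algebra.Definitions.RawSemiring +-*-rawSemiring
  using () renaming (_^_ to _^ℚ_)
open import Algebra.Properties.Semiring.Sum (CommutativeRing.semiring ℚ.+-*-commutativeRing)
  using (sum; sum-cong-≗)
open +-*-Solver using (solve; con; _:+_; _:*_; _:-_; :-_; _:=_)
open Graph
open ℚ-Lemmas

-- Power series

tail : (ℕ → ℚ) → ℕ → ℚ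
tail f n = f (suc n)

psum : (ℕ → ℚ) → ℕ → ℚ
psum f zero    = 0ℚ
psum f (suc m) = f 0 + psum (tail f) m

psum-snoc : ∀ f m → psum f (suc m) ≡ psum f m + f m
psum-snoc f zero    = ℚ.+-comm (f 0) 0ℚ
psum-snoc f (suc m) = trans (cong (f 0 +_) (psum-snoc (tail f) m))
  (sym (ℚ.+-assoc (f 0) (psum (tail f) m) (f (suc m))))

psum-cong : ∀ {f g} → (∀ j → f j ≡ g j) → ∀ m → psum f m ≡ psum g m
psum-cong f≗g zero    = refl
psum-cong f≗g (suc m) = cong₂ _+_ (f≗g 0) (psum-cong (λ j → f≗g (suc j)) m)

psum-linear : ∀ p q f g m → psum (λ j → p * f j + q * g j) m ≡ p * psum f m + q * psum g m
psum-linear p q f g zero    = lemma p q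
  where
  lemma : ∀ p q → 0ℚ ≡ p * 0ℚ + q * 0ℚ
  lemma = solve 2 (λ p q → con 0ℚ := p :* con 0ℚ :+ q :* con 0ℚ) refl
psum-linear p q f g (suc m) = trans
  (cong (p * f 0 + q * g 0 +_) (psum-linear p q (tail f) (tail g) m))
  (lemma p q (f 0) (g 0) (psum (tail f) m) (psum (tail g) m))
  where
  lemma : ∀ p q a b s t → (p * a + q * b) + (p * s + q * t) ≡ p * (a + s) + q * (b + t)
  lemma = solve 6 (λ p q a b s t →
    (p :* a :+ q :* b) :+ (p :* s :+ q :* t) := p :* (a :+ s) :+ q :* (b :+ t)) refl

conv : (ℕ → ℚ) → (ℕ → ℚ) → ℕ → ℚ
conv f g zero    = f 0 * g 0
conv f g (suc n) = f 0 * g (suc n) + conv (tail f) g n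

conv-cong : ∀ {f f′ g g′} → (∀ j → f j ≡ f′ j) → (∀ j → g j ≡ g′ j) → ∀ n → conv f g n ≡ conv f′ g′ n
conv-cong f≗ g≗ zero    = cong₂ _*_ (f≗ 0) (g≗ 0)
conv-cong f≗ g≗ (suc n) = cong₂ _+_ (cong₂ _*_ (f≗ 0) (g≗ (suc n)))
  (conv-cong (λ j → f≗ (suc j)) g≗ n)

conv-+ˡ : ∀ f f′ g n → conv (λ j → f j + f′ j) g n ≡ conv f g n + conv f′ g n
conv-+ˡ f f′ g zero    = ℚ.*-distribʳ-+ (g 0) (f 0) (f′ 0)
conv-+ˡ f f′ g (suc n) = trans
  (cong ((f 0 + f′ 0) * g (suc n) +_) (conv-+ˡ (tail f) (tail f′) g n))
  (lemma (f 0) (f′ 0) (g (suc n)) (conv (tail f) g n) (conv (tail f′) g n))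
  where
  lemma : ∀ a b c s t → (a + b) * c + (s + t) ≡ (a * c + s) + (b * c + t)
  lemma = solve 5 (λ a b c s t → (a :+ b) :* c :+ (s :+ t) := (a :* c :+ s) :+ (b :* c :+ t)) refl

conv-scaleˡ : ∀ p f g n → conv (λ j → p * f j) g n ≡ p * conv f g n
conv-scaleˡ p f g zero    = ℚ.*-assoc p (f 0) (g 0)
conv-scaleˡ p f g (suc n) = trans (cong (p * f 0 * g (suc n) +_) (conv-scaleˡ p (tail f) g n))
  (lemma p (f 0) (g (suc n)) (conv (tail f) g n))
  where
  lemma : ∀ p a b s → p * a * b + p * s ≡ p * (a * b + s)
  lemma = solve 4 (λ p a b s → p :* a :* b :+ p :* s := p :* (a :* b :+ s)) refl

conv-scaleʳ : ∀ p f g n → conv f (λ j → p * g j) n ≡ p * conv f g n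
conv-scaleʳ p f g zero    = lemma p (f 0) (g 0)
  where
  lemma : ∀ p a b → a * (p * b) ≡ p * (a * b)
  lemma = solve 3 (λ p a b → a :* (p :* b) := p :* (a :* b)) refl
conv-scaleʳ p f g (suc n) = trans (cong (f 0 * (p * g (suc n)) +_) (conv-scaleʳ p (tail f) g n))
  (lemma p (f 0) (g (suc n)) (conv (tail f) g n))
  where
  lemma : ∀ p a b s → a * (p * b) + p * s ≡ p * (a * b + s)
  lemma = solve 4 (λ p a b s → a :* (p :* b) :+ p :* s := p :* (a :* b :+ s)) refl

fromℕℚ : ℕ → ℚ
fromℕℚ zero    = 0ℚ
fromℕℚ (suc n) = 1ℚ + fromℕℚ n

∂ : (ℕ → ℚ) → ℕ → ℚ
∂ f n = fromℕℚ (suc n) * f (suc n)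

∂-conv : ∀ f g n → ∂ (conv f g) n ≡ conv (∂ f) g n + conv f (∂ g) n
∂-conv f g zero    = lemma (f 0) (f 1) (g 0) (g 1)
  where
  lemma : ∀ a b c d → (1ℚ + 0ℚ) * (a * d + b * c) ≡ (1ℚ + 0ℚ) * b * c + a * ((1ℚ + 0ℚ) * d)
  lemma = solve 4 (λ a b c d → (con 1ℚ :+ con 0ℚ) :* (a :* d :+ b :* c) :=
    (con 1ℚ :+ con 0ℚ) :* b :* c :+ a :* ((con 1ℚ :+ con 0ℚ) :* d)) refl
∂-conv f g (suc n) = begin
  (1ℚ + k) * (f 0 * g (2 ℕ.+ n) + conv (tail f) g (suc n))
    ≡⟨ lemma₁ k (f 0) (g (2 ℕ.+ n)) (conv (tail f) g (suc n)) ⟩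
  f 0 * ∂ g (suc n) + (k * conv (tail f) g (suc n) + conv (tail f) g (suc n))
    ≡⟨ cong (λ z → f 0 * ∂ g (suc n) + (z + conv (tail f) g (suc n))) (∂-conv (tail f) g n) ⟩
  f 0 * ∂ g (suc n) + ((conv (∂ (tail f)) g n + conv (tail f) (∂ g) n)
    + (f 1 * g (suc n) + conv (tail (tail f)) g n))
    ≡⟨ lemma₂ (f 0 * ∂ g (suc n)) (conv (∂ (tail f)) g n) (conv (tail f) (∂ g) n) (f 1) (g (suc n))
         (conv (tail (tail f)) g n) ⟩
  (∂ f 0 * g (suc n) + (conv (tail (tail f)) g n + conv (∂ (tail f)) g n))
    + (f 0 * ∂ g (suc n) + conv (tail f) (∂ g) n)
    ≡⟨ cong (λ z → (∂ f 0 * g (suc n) + z) + (f 0 * ∂ g (suc n) + conv (tail f) (∂ g) n))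
         (sym (trans (conv-cong {g = g} (λ j → lemma₃ (fromℕℚ (suc j)) (f (2 ℕ.+ j))) (λ _ → refl) n)
           (conv-+ˡ (tail (tail f)) (∂ (tail f)) g n))) ⟩
  (∂ f 0 * g (suc n) + conv (tail (∂ f)) g n) + (f 0 * ∂ g (suc n) + conv (tail f) (∂ g) n) ∎
  where
  open ≡-Reasoning
  k = fromℕℚ (suc n)
  lemma₁ : ∀ k a b s → (1ℚ + k) * (a * b + s) ≡ a * ((1ℚ + k) * b) + (k * s + s)
  lemma₁ = solve 4 (λ k a b s → (con 1ℚ :+ k) :* (a :* b :+ s) :=
    a :* ((con 1ℚ :+ k) :* b) :+ (k :* s :+ s)) refl
  lemma₂ : ∀ a s t b c u → a + ((s + t) + (b * c + u)) ≡ ((1ℚ + 0ℚ) * b * c + (u + s)) + (a + t)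
  lemma₂ = solve 6 (λ a s t b c u → a :+ ((s :+ t) :+ (b :* c :+ u)) :=
    ((con 1ℚ :+ con 0ℚ) :* b :* c :+ (u :+ s)) :+ (a :+ t)) refl
  lemma₃ : ∀ k b → (1ℚ + k) * b ≡ b + k * b
  lemma₃ = solve 2 (λ k b → (con 1ℚ :+ k) :* b := b :+ k :* b) refl

unit-inverse : ∀ n → unit n * fromℕℚ (suc n) ≡ 1ℚ
unit-inverse n = trans (cong (unit n *_) (fromℕℚ≡ (suc n)))
  (ℚ.toℚᵘ-injective (ℚᵘ.≃-trans (ℚ.toℚᵘ-homo-* (unit n) (ℤ.+ suc n / 1))
    (ℚᵘ.≃-trans (ℚᵘ.*-cong (ℚ.toℚᵘ-fromℚᵘ (mkℚᵘ (ℤ.+ 1) n)) (ℚ.toℚᵘ-fromℚᵘ (mkℚᵘ (ℤ.+ suc n) 0)))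
      (ℚᵘ.*≡* (lemma (ℤ.+ suc n))))))
  where
  lemma : ∀ z → (ℤ.+ 1 ℤ.* z) ℤ.* ℤ.+ 1 ≡ ℤ.+ 1 ℤ.* (z ℤ.* ℤ.+ 1)
  lemma z = ℤ.*-assoc (ℤ.+ 1) z (ℤ.+ 1)
  fromℕℚ≡ : ∀ m → fromℕℚ m ≡ ℤ.+ m / 1
  fromℕℚ≡ zero    = refl
  fromℕℚ≡ (suc m) = trans (cong (1ℚ +_) (fromℕℚ≡ m))
    (ℚ.toℚᵘ-injective (ℚᵘ.≃-trans (ℚ.toℚᵘ-homo-+ 1ℚ (ℤ.+ m / 1))
      (ℚᵘ.≃-trans (ℚᵘ.+-congʳ (mkℚᵘ (ℤ.+ 1) 0) (ℚ.toℚᵘ-fromℚᵘ (mkℚᵘ (ℤ.+ m) 0)))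
        (ℚᵘ.≃-trans (ℚᵘ.*≡* (add (ℤ.+ m)))
          (ℚᵘ.≃-sym (ℚ.toℚᵘ-fromℚᵘ (mkℚᵘ (ℤ.+ suc m) 0)))))))
    where
    add : ∀ z → (ℤ.+ 1 ℤ.* ℤ.+ 1 ℤ.+ z ℤ.* ℤ.+ 1) ℤ.* ℤ.+ 1 ≡ (ℤ.+ 1 ℤ.+ z) ℤ.* (ℤ.+ 1 ℤ.* ℤ.+ 1)
    add z = trans (ℤ.*-identityʳ (ℤ.+ 1 ℤ.+ z ℤ.* ℤ.+ 1))
      (trans (cong (λ y → ℤ.+ 1 ℤ.+ y) (ℤ.*-identityʳ z)) (sym (ℤ.*-identityʳ (ℤ.+ 1 ℤ.+ z))))

scaled-∂ : ∀ f n → f (suc n) ≡ unit n * ∂ f n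
scaled-∂ f n = sym (trans (sym (ℚ.*-assoc (unit n) (fromℕℚ (suc n)) (f (suc n))))
  (trans (cong (_* f (suc n)) (unit-inverse n)) (ℚ.*-identityˡ (f (suc n)))))

∂-unit : ∀ n p → fromℕℚ (suc n) * (unit n * p) ≡ p
∂-unit n p = trans (lemma (fromℕℚ (suc n)) (unit n) p)
  (trans (cong (_* p) (unit-inverse n)) (ℚ.*-identityˡ p))
  where
  lemma : ∀ k u p → k * (u * p) ≡ (u * k) * p
  lemma = solve 3 (λ k u p → k :* (u :* p) := (u :* k) :* p) refl

-- (i y)ʲ / j! = cosTerm y j + i sinTerm y j
cosTerm sinTerm : ℚ → ℕ → ℚ
cosTerm y zero    = 1ℚ
cosTerm y (suc j) = unit j * - (y * sinTerm y j)
sinTerm y zero    = 0ℚ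
sinTerm y (suc j) = unit j * (y * cosTerm y j)

∂-cos : ∀ y j → ∂ (cosTerm y) j ≡ (- y) * sinTerm y j
∂-cos y j = trans (∂-unit j (- (y * sinTerm y j))) (ℚ.neg-distribˡ-* y (sinTerm y j))

∂-sin : ∀ y j → ∂ (sinTerm y) j ≡ y * cosTerm y j
∂-sin y j = ∂-unit j (y * cosTerm y j)

module _ (D s x : ℚ) where

  -- The Taylor coefficients of exp (ixM) on v and on w, where M v = D v + s w
  -- and M w = s v + D w, are cos x · exp (iDx) and is sin x · exp (iDx).
  vRe vIm wRe wIm : ℕ → ℚ
  vRe = conv (cosTerm (D * x)) (cosTerm x)
  vIm = conv (sinTerm (D * x)) (cosTerm x)
  wRe j = (- s) * conv (sinTerm (D * x)) (sinTerm x) j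
  wIm j = s * conv (cosTerm (D * x)) (sinTerm x) j

  private
    ∂-product : ∀ {f g f′ g′} p q → (∀ j → ∂ f j ≡ p * f′ j) → (∀ j → ∂ g j ≡ q * g′ j) →
                ∀ j → ∂ (conv f g) j ≡ p * conv f′ g j + q * conv f g′ j
    ∂-product {f} {g} {f′} {g′} p q f-eq g-eq j = trans (∂-conv f g j) (cong₂ _+_
      (trans (conv-cong {g = g} f-eq (λ _ → refl) j) (conv-scaleˡ p f′ g j))
      (trans (conv-cong {f} (λ _ → refl) g-eq j) (conv-scaleʳ q f g′ j)))

    Dcos = ∂-cos (D * x)
    Dsin = ∂-sin (D * x)

  vRe-suc : s * s ≡ 1ℚ → ∀ j → vRe (suc j) ≡ unit j * - (x * (D * vIm j + s * wIm j))
  vRe-suc s*s≡1 j = trans (scaled-∂ vRe j) (cong (unit j *_)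
    (trans (∂-product {cosTerm (D * x)} {cosTerm x} (- (D * x)) (- x) Dcos (∂-cos x) j)
      (trans (cong (λ t → - (D * x) * vIm j + - x * t) (sym (ℚ.*-identityˡ cs)))
      (trans (cong (λ t → - (D * x) * vIm j + - x * (t * cs)) (sym s*s≡1))
        (lemma D x (vIm j) cs s)))))
    where
    cs = conv (cosTerm (D * x)) (sinTerm x) j
    lemma : ∀ D x a b s → - (D * x) * a + - x * ((s * s) * b) ≡ - (x * (D * a + s * (s * b)))
    lemma = solve 5 (λ D x a b s → :- (D :* x) :* a :+ :- x :* ((s :* s) :* b) :=
      :- (x :* (D :* a :+ s :* (s :* b)))) refl

  vIm-suc : s * s ≡ 1ℚ → ∀ j → vIm (suc j) ≡ unit j * (x * (D * vRe j + s * wRe j))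
  vIm-suc s*s≡1 j = trans (scaled-∂ vIm j) (cong (unit j *_)
    (trans (∂-product {sinTerm (D * x)} {cosTerm x} (D * x) (- x) Dsin (∂-cos x) j)
      (trans (cong (λ t → (D * x) * vRe j + - x * t) (sym (ℚ.*-identityˡ ss)))
      (trans (cong (λ t → (D * x) * vRe j + - x * (t * ss)) (sym s*s≡1))
        (lemma D x (vRe j) ss s)))))
    where
    ss = conv (sinTerm (D * x)) (sinTerm x) j
    lemma : ∀ D x a b s → (D * x) * a + - x * ((s * s) * b) ≡ x * (D * a + s * (- s * b))
    lemma = solve 5 (λ D x a b s → (D :* x) :* a :+ :- x :* ((s :* s) :* b) :=
      x :* (D :* a :+ s :* (:- s :* b))) refl

  wRe-suc : ∀ j → wRe (suc j) ≡ unit j * - (x * (s * vIm j + D * wIm j))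
  wRe-suc j = trans (cong (- s *_) (trans (scaled-∂ ss j) (cong (unit j *_)
    (∂-product {sinTerm (D * x)} {sinTerm x} (D * x) x Dsin (∂-sin x) j))))
      (lemma s (unit j) D x (conv (cosTerm (D * x)) (sinTerm x) j) (vIm j))
    where
    ss = conv (sinTerm (D * x)) (sinTerm x)
    lemma : ∀ s u D x b a → - s * (u * ((D * x) * b + x * a)) ≡ u * - (x * (s * a + D * (s * b)))
    lemma = solve 6 (λ s u D x b a → :- s :* (u :* ((D :* x) :* b :+ x :* a)) :=
      u :* :- (x :* (s :* a :+ D :* (s :* b)))) refl

  wIm-suc : ∀ j → wIm (suc j) ≡ unit j * (x * (s * vRe j + D * wRe j))
  wIm-suc j = trans (cong (s *_) (trans (scaled-∂ cs j) (cong (unit j *_)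
    (∂-product {cosTerm (D * x)} {sinTerm x} (- (D * x)) x Dcos (∂-sin x) j))))
      (lemma s (unit j) D x (conv (sinTerm (D * x)) (sinTerm x) j) (vRe j))
    where
    cs = conv (cosTerm (D * x)) (sinTerm x)
    lemma : ∀ s u D x b a → s * (u * (- (D * x) * b + x * a)) ≡ u * (x * (s * a + D * (- s * b)))
    lemma = solve 6 (λ s u D x b a → s :* (u :* (:- (D :* x) :* b :+ x :* a)) :=
      u :* (x :* (s :* a :+ D :* (:- s :* b)))) refl

-- Bounds and limits

record Geometric (f : ℕ → ℚ) (K : ℚ) : Set where
  constructor geometric
  field bound : ∀ j → ∣ f j ∣ ℚ.≤ K * ½ ^ℚ j

open Geometric

geometric-tail : ∀ {f K} → Geometric f K → Geometric (tail f) (K * ½)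
geometric-tail {f} {K} f≲K = geometric λ j →
  widen (sym (ℚ.*-assoc K ½ (½ ^ℚ j))) (bound f≲K (suc j))

geometric-head : ∀ {f K} → Geometric f K → ∣ f 0 ∣ ℚ.≤ K
geometric-head {K = K} f≲K = widen (ℚ.*-identityʳ K) (bound f≲K 0)

psum-bound : ∀ f {K} → Geometric f K → ∀ m → ∣ psum f m ∣ ℚ.≤ K + K
psum-bound f {K} f≲K zero    = +-nonNeg 0≤K 0≤K
  where 0≤K = ℚ.≤-trans (ℚ.0≤∣p∣ (f 0)) (geometric-head f≲K)
psum-bound f {K} f≲K (suc m) = ℚ.≤-trans (ℚ.∣p+q∣≤∣p∣+∣q∣ (f 0) (psum (tail f) m))
  (widen (cong (K +_) (half+half K))
    (ℚ.+-mono-≤ (geometric-head f≲K) (psum-bound (tail f) (geometric-tail f≲K) m)))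

psum-tail : ∀ f {K} → Geometric f K → ∀ m d →
            ∣ psum f (m ℕ.+ d) - psum f m ∣ ℚ.≤ (K + K) * ½ ^ℚ m
psum-tail f {K} f≲K zero    d = subst₂ ℚ._≤_
  (cong ∣_∣ (sym (ℚ.+-identityʳ (psum f d)))) (sym (ℚ.*-identityʳ (K + K))) (psum-bound f f≲K d)
psum-tail f {K} f≲K (suc m) d = subst₂ ℚ._≤_
  (cong ∣_∣ (sym (cancel (f 0) (psum (tail f) (m ℕ.+ d)) (psum (tail f) m))))
  (shift K (½ ^ℚ m)) (psum-tail (tail f) (geometric-tail f≲K) m d)
  where
  cancel : ∀ a s t → (a + s) - (a + t) ≡ s - t
  cancel = solve 3 (λ a s t → (a :+ s) :- (a :+ t) := s :- t) refl
  shift : ∀ K p → (K * ½ + K * ½) * p ≡ (K + K) * (½ * p)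
  shift = solve 2 (λ K p → (K :* con ½ :+ K :* con ½) :* p := (K :+ K) :* (con ½ :* p)) refl

halving⇒geometric : ∀ N f → (∀ j → 0ℚ ℚ.≤ f j) → (∀ j → N ℕ.≤ j → f (suc j) + f (suc j) ℚ.≤ f j) →
                    ∃[ K ] 0ℚ ℚ.< K × Geometric f K
halving⇒geometric zero    f 0≤f halving = f 0 + 1ℚ , ℚ.+-mono-≤-< (0≤f 0) 0<1 , geometric λ j →
  subst (ℚ._≤ (f 0 + 1ℚ) * ½ ^ℚ j) (sym (ℚ.0≤p⇒∣p∣≡p (0≤f j)))
    (ℚ.≤-trans (go j) (ℚ.*-monoʳ-≤-nonNeg (½ ^ℚ j) {{nonNegative (½^-nonNeg j)}}
      (≤-weaken (ℚ.≤-refl {f 0}) (ℚ.<⇒≤ 0<1))))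
  where
  ½^-nonNeg : ∀ j → 0ℚ ℚ.≤ ½ ^ℚ j
  ½^-nonNeg j = HalfPi.^-nonNeg j (ℚ.<⇒≤ (half-pos 0<1))
  halve : ∀ p → (p + p) * ½ ≡ p
  halve = solve 1 (λ p → (p :+ p) :* con ½ := p) refl
  swap : ∀ a p → (a * p) * ½ ≡ a * (½ * p)
  swap = solve 2 (λ a p → (a :* p) :* con ½ := a :* (con ½ :* p)) refl
  go : ∀ j → f j ℚ.≤ f 0 * ½ ^ℚ j
  go zero    = ℚ.≤-reflexive (sym (ℚ.*-identityʳ (f 0)))
  go (suc j) = subst₂ ℚ._≤_ (halve (f (suc j))) (swap (f 0) (½ ^ℚ j))
    (ℚ.*-monoʳ-≤-nonNeg ½ (ℚ.≤-trans (halving j ℕ.z≤n) (go j)))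
halving⇒geometric (suc N) f 0≤f halving =
  let K , 0<K , f≲K = halving⇒geometric N (tail f) (λ j → 0≤f (suc j))
                        (λ j N≤j → halving (suc j) (ℕ.s≤s N≤j))
  in f 0 + (K + K) , ℚ.+-mono-≤-< (0≤f 0) (+-pos 0<K 0<K) , geometric λ where
       zero    → subst₂ ℚ._≤_ (sym (ℚ.0≤p⇒∣p∣≡p (0≤f 0))) (sym (ℚ.*-identityʳ (f 0 + (K + K))))
                   (≤-weaken ℚ.≤-refl (ℚ.<⇒≤ (+-pos 0<K 0<K)))
       (suc j) → ℚ.≤-trans (bound f≲K j) (subst₂ ℚ._≤_ (lemma K (½ ^ℚ j)) (lemma′ (f 0) K (½ ^ℚ j))
         (ℚ.*-monoʳ-≤-nonNeg (½ ^ℚ j) {{nonNegative (HalfPi.^-nonNeg j (ℚ.<⇒≤ (half-pos 0<1)))}}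
           (ℚ.+-monoˡ-≤ K (*-nonNeg (0≤f 0) (ℚ.<⇒≤ (half-pos 0<1))))))
  where
  lemma : ∀ K p → (0ℚ + K) * p ≡ K * p
  lemma = solve 2 (λ K p → (con 0ℚ :+ K) :* p := K :* p) refl
  lemma′ : ∀ a K p → (a * (1ℚ * ½) + K) * p ≡ (a + (K + K)) * (½ * p)
  lemma′ = solve 3 (λ a K p → (a :* (con 1ℚ :* con ½) :+ K) :* p := (a :+ (K :+ K)) :* (con ½ :* p)) refl

expBound : ℚ → ℕ → ℚ
expBound B zero    = 1ℚ
expBound B (suc j) = unit j * (B * expBound B j)

expBound-nonNeg : ∀ {B} → 0ℚ ℚ.≤ B → ∀ j → 0ℚ ℚ.≤ expBound B j
expBound-nonNeg 0≤B zero    = ℚ.<⇒≤ 0<1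
expBound-nonNeg 0≤B (suc j) = *-nonNeg (ℚ.<⇒≤ (unit-pos j)) (*-nonNeg 0≤B (expBound-nonNeg 0≤B j))

expBound-geometric : ∀ {B} → 0ℚ ℚ.< B → ∃[ K ] 0ℚ ℚ.< K × Geometric (expBound B) K
expBound-geometric {B} 0<B =
  let r , 0<r , r*2B≡1 = recip (+-pos 0<B 0<B)
      N , small = unit-small r 0<r
      b = expBound B
      0≤b = expBound-nonNeg (ℚ.<⇒≤ 0<B)
  in halving⇒geometric N b 0≤b λ j N≤j →
       subst₂ ℚ._≤_ (lemma (unit j) B (b j)) (trans (cong (_* b j) r*2B≡1) (ℚ.*-identityˡ (b j)))
         (ℚ.*-monoʳ-≤-nonNeg (b j) {{nonNegative (0≤b j)}}
           (ℚ.*-monoʳ-≤-nonNeg (B + B) {{nonNegative (ℚ.<⇒≤ (+-pos 0<B 0<B))}} (small j N≤j)))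
  where
  lemma : ∀ u B p → (u * (B + B)) * p ≡ u * (B * p) + u * (B * p)
  lemma = solve 3 (λ u B p → (u :* (B :+ B)) :* p := u :* (B :* p) :+ u :* (B :* p)) refl

terms-bound : ∀ {B} y → ∣ y ∣ ℚ.≤ B → ∀ j →
              ∣ cosTerm y j ∣ ℚ.≤ expBound B j × ∣ sinTerm y j ∣ ℚ.≤ expBound B j
terms-bound {B} y y≤B zero    = ℚ.≤-refl , ℚ.<⇒≤ 0<1
terms-bound {B} y y≤B (suc j) =
  let cos≤ , sin≤ = terms-bound y y≤B j
  in subst (ℚ._≤ expBound B (suc j))
       (sym (trans (abs-unit (- (y * sinTerm y j)))
         (cong (unit j *_) (ℚ.∣-p∣≡∣p∣ (y * sinTerm y j))))) (step sin≤)
   , subst (ℚ._≤ expBound B (suc j)) (sym (abs-unit (y * cosTerm y j))) (step cos≤)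
  where
  abs-unit : ∀ p → ∣ unit j * p ∣ ≡ unit j * ∣ p ∣
  abs-unit p = trans (ℚ.∣p*q∣≡∣p∣*∣q∣ (unit j) p)
    (cong (_* ∣ p ∣) (ℚ.0≤p⇒∣p∣≡p (ℚ.<⇒≤ (unit-pos j))))
  step : ∀ {p} → ∣ p ∣ ℚ.≤ expBound B j → unit j * ∣ y * p ∣ ℚ.≤ expBound B (suc j)
  step {p} p≤ = ℚ.*-monoˡ-≤-nonNeg (unit j) {{nonNegative (ℚ.<⇒≤ (unit-pos j))}}
    (subst (ℚ._≤ B * expBound B j) (sym (ℚ.∣p*q∣≡∣p∣*∣q∣ y p))
      (*-mono (ℚ.≤-trans (ℚ.0≤∣p∣ y) y≤B) (ℚ.0≤∣p∣ p) y≤B p≤))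

terms-geometric : ∀ {B} → 0ℚ ℚ.< B → ∃[ K ] 0ℚ ℚ.< K ×
                  (∀ y → ∣ y ∣ ℚ.≤ B → Geometric (cosTerm y) K × Geometric (sinTerm y) K)
terms-geometric {B} 0<B =
  let K , 0<K , b≲K = expBound-geometric 0<B
      weaken = λ j → ℚ.≤-trans (HalfPi.≤-abs (expBound B j)) (bound b≲K j)
  in K , 0<K , λ y y≤B →
       geometric (λ j → ℚ.≤-trans (proj₁ (terms-bound y y≤B j)) (weaken j)) ,
       geometric (λ j → ℚ.≤-trans (proj₂ (terms-bound y y≤B j)) (weaken j))

smoothed : (ℕ → ℚ) → ℕ → ℚ
smoothed f zero    = 0ℚ
smoothed f (suc m) = ∣ psum f (suc m) ∣ + smoothed f m * ½

smoothed-bound : ∀ f {E} → (∀ m → ∣ psum f m ∣ ℚ.≤ E) → ∀ m → smoothed f m ℚ.≤ E + E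
smoothed-bound f {E} f≤E zero    = +-nonNeg 0≤E 0≤E
  where 0≤E = f≤E 0
smoothed-bound f {E} f≤E (suc m) = widen (cong (E +_) (lemma E))
  (ℚ.+-mono-≤ (f≤E (suc m)) (ℚ.*-monoʳ-≤-nonNeg ½ (smoothed-bound f f≤E m)))
  where
  lemma : ∀ E → (E + E) * ½ ≡ E
  lemma = solve 1 (λ E → (E :+ E) :* con ½ := E) refl

smoothed-tail : ∀ f {E} {ε} N → (∀ m → ∣ psum f m ∣ ℚ.≤ E) → 0ℚ ℚ.≤ ε → (∀ m → N ℕ.≤ m → ∣ psum f m ∣ ℚ.≤ ε) →
                ∀ d → smoothed f (d ℕ.+ N) ℚ.≤ (ε + ε) + (E + E) * ½ ^ℚ d
smoothed-tail f {E} {ε} N f≤E 0≤ε f≤ε zero    = subst₂ ℚ._≤_ (ℚ.+-identityˡ (smoothed f N))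
  (cong ((ε + ε) +_) (sym (ℚ.*-identityʳ (E + E))))
  (ℚ.+-mono-≤ (+-nonNeg 0≤ε 0≤ε) (smoothed-bound f f≤E N))
smoothed-tail f {E} {ε} N f≤E 0≤ε f≤ε (suc d) = widen (lemma ε E (½ ^ℚ d))
  (ℚ.+-mono-≤ (f≤ε (suc d ℕ.+ N) (ℕ.m≤n+m N (suc d)))
    (ℚ.*-monoʳ-≤-nonNeg ½ (smoothed-tail f N f≤E 0≤ε f≤ε d)))
  where
  lemma : ∀ ε E p → ε + ((ε + ε) + (E + E) * p) * ½ ≡ (ε + ε) + (E + E) * (½ * p)
  lemma = solve 3 (λ ε E p → ε :+ ((ε :+ ε) :+ (E :+ E) :* p) :* con ½ :=
    (ε :+ ε) :+ (E :+ E) :* (con ½ :* p)) refl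

psum-conv : ∀ f g m → psum (conv f g) (suc m) ≡ f 0 * psum g (suc m) + psum (conv (tail f) g) m
psum-conv f g m = trans (cong (f 0 * g 0 +_) (go m))
  (lemma (f 0) (g 0) (psum (tail g) m) (psum (conv (tail f) g) m))
  where
  go : ∀ m → psum (tail (conv f g)) m ≡ f 0 * psum (tail g) m + psum (conv (tail f) g) m
  go m = trans (psum-cong (λ j → cong (f 0 * g (suc j) +_) (sym (ℚ.*-identityˡ (conv (tail f) g j)))) m)
    (trans (psum-linear (f 0) 1ℚ (tail g) (conv (tail f) g) m)
      (cong (f 0 * psum (tail g) m +_) (ℚ.*-identityˡ (psum (conv (tail f) g) m))))
  lemma : ∀ a b s t → a * b + (a * s + t) ≡ a * (b + s) + t
  lemma = solve 4 (λ a b s t → a :* b :+ (a :* s :+ t) := a :* (b :+ s) :+ t) refl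

conv-smoothed : ∀ f g {K} → Geometric f K → ∀ m → ∣ psum (conv f g) m ∣ ℚ.≤ K * smoothed g m
conv-smoothed f g {K} f≲K zero    = ℚ.≤-reflexive (sym (ℚ.*-zeroʳ K))
conv-smoothed f g {K} f≲K (suc m) = subst (λ p → ∣ p ∣ ℚ.≤ K * smoothed g (suc m)) (sym (psum-conv f g m))
  (ℚ.≤-trans (ℚ.∣p+q∣≤∣p∣+∣q∣ (f 0 * psum g (suc m)) (psum (conv (tail f) g) m))
    (widen (lemma K ∣ psum g (suc m) ∣ (smoothed g m))
      (ℚ.+-mono-≤
        (subst (ℚ._≤ K * ∣ psum g (suc m) ∣) (sym (ℚ.∣p*q∣≡∣p∣*∣q∣ (f 0) (psum g (suc m))))
          (ℚ.*-monoʳ-≤-nonNeg ∣ psum g (suc m) ∣ {{nonNegative (ℚ.0≤∣p∣ (psum g (suc m)))}}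
            (geometric-head f≲K)))
        (conv-smoothed (tail f) g (geometric-tail f≲K) m))))
  where
  lemma : ∀ K p q → K * p + (K * ½) * q ≡ K * (p + q * ½)
  lemma = solve 3 (λ K p q → K :* p :+ (K :* con ½) :* q := K :* (p :+ q :* con ½)) refl

½^-vanish : ∀ {c} → 0ℚ ℚ.≤ c → ∀ ε → 0ℚ ℚ.< ε → Eventually λ n → c * ½ ^ℚ n ℚ.≤ ε
½^-vanish {c} 0≤c = Decay.vanish (λ n → c * ½ ^ℚ n)
  (λ n → *-nonNeg 0≤c (HalfPi.^-nonNeg n (ℚ.<⇒≤ (half-pos 0<1)))) 0
  (λ n _ → ℚ.≤-reflexive (halve c (½ ^ℚ n)))
  where
  halve : ∀ c p → c * (½ * p) + c * (½ * p) ≡ c * p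
  halve = solve 2 (λ c p → c :* (con ½ :* p) :+ c :* (con ½ :* p) := c :* p) refl

infix 4 _⇉_

-- The rows p m converge to z up to the index m of the approximation, with n
-- large depending on m; convergence of real sequences has this form.
record _⇉_ (p : ℕ → ℕ → ℚ) (z : ℕ → ℚ) : Set where
  constructor converging
  field close : ∀ ε → 0ℚ ℚ.< ε → Eventually λ m → Eventually λ n → ∣ p m n - z n ∣ ℚ.≤ ε

open _⇉_

⇉-cong : ∀ {p p′ z z′} → (∀ m n → p m n ≡ p′ m n) → (∀ n → z n ≡ z′ n) → p ⇉ z → p′ ⇉ z′
⇉-cong p≗ z≗ p⇉z .close ε 0<ε = each
  (λ m → each λ n → subst (ℚ._≤ ε) (cong₂ (λ a b → ∣ a - b ∣) (p≗ m n) (z≗ n))) (close p⇉z ε 0<ε)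

⇉-+ : ∀ {p q y z} → p ⇉ y → q ⇉ z → (λ m n → p m n + q m n) ⇉ (λ n → y n + z n)
⇉-+ {p} {q} {y} {z} p⇉y q⇉z .close ε 0<ε = both
  (λ m → both λ n a b → ℚ.≤-trans (add-sub (p m n) (q m n) (y n) (z n))
    (widen (half+half ε) (ℚ.+-mono-≤ a b)))
  (close p⇉y (ε * ½) (half-pos 0<ε)) (close q⇉z (ε * ½) (half-pos 0<ε))

⇉-scale : ∀ {p z} c → p ⇉ z → (λ m n → c * p m n) ⇉ (λ n → c * z n)
⇉-scale {p} {z} c p⇉z .close ε 0<ε =
  let r , 0<r , r*c′≡1 = recip (ℚ.+-mono-≤-< (ℚ.0≤∣p∣ c) 0<1)
  in each (λ m → each λ n a → subst (ℚ._≤ ε)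
       (sym (trans (cong ∣_∣ (factor c (p m n) (z n))) (ℚ.∣p*q∣≡∣p∣*∣q∣ c (p m n - z n))))
       (widen (trans (lemma (∣ c ∣ + 1ℚ) ε r) (trans (cong (ε *_) r*c′≡1) (ℚ.*-identityʳ ε)))
         (*-mono (+-nonNeg (ℚ.0≤∣p∣ c) (ℚ.<⇒≤ 0<1)) (ℚ.0≤∣p∣ (p m n - z n))
           (≤-weaken (ℚ.≤-refl {∣ c ∣}) (ℚ.<⇒≤ 0<1)) a)))
     (close p⇉z (ε * r) (*-pos 0<ε 0<r))
  where
  factor : ∀ c p q → c * p - c * q ≡ c * (p - q)
  factor = solve 3 (λ c p q → c :* p :- c :* q := c :* (p :- q)) refl
  lemma : ∀ c ε r → c * (ε * r) ≡ ε * (r * c)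
  lemma = solve 3 (λ c ε r → c :* (ε :* r) := ε :* (r :* c)) refl

⇉-unique : ∀ {p y z} → p ⇉ y → p ⇉ z → ∀ ε → 0ℚ ℚ.< ε → Eventually λ n → ∣ y n - z n ∣ ℚ.≤ ε
⇉-unique {p} {y} {z} p⇉y p⇉z ε 0<ε =
  let M , at-M = both (λ _ → _,_) (close p⇉y (ε * ½) (half-pos 0<ε)) (close p⇉z (ε * ½) (half-pos 0<ε))
      a , b = at-M M ℕ.≤-refl
  in both (λ n a b → ℚ.≤-trans (triangle (y n) (p M n) (z n))
       (widen (half+half ε) (ℚ.+-mono-≤ (subst (ℚ._≤ ε * ½) (abs-sub-comm (p M n) (y n)) a) b))) a b

⟶⇒⇉ : ∀ s l → s ⟶ l → (λ m n → approx (s m) n) ⇉ approx l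
⟶⇒⇉ s l s⟶l .close ε 0<ε = each
  (λ m near → each (λ n → widen (half+half ε)) (near (ε * ½) (half-pos 0<ε)))
  (s⟶l (ε * ½) (half-pos 0<ε))

-- psum (conv f g) m is bounded by the geometrically weighted average of the
-- partial sums of g, so it vanishes in the limit when these do.
conv-null : ∀ {K} (f g : ℕ → ℕ → ℚ) → 0ℚ ℚ.< K →
            Eventually (λ n → Geometric (f n) K) → Eventually (λ n → Geometric (g n) K) →
            (λ m n → psum (g n) m) ⇉ (λ _ → 0ℚ) → (λ m n → psum (conv (f n) (g n)) m) ⇉ (λ _ → 0ℚ)
conv-null {K} f g 0<K f≲K g≲K g⇉0 .close ε 0<ε = d₀ ℕ.+ N , λ m ≤m →
  both (λ n f≲K (g≲K , g≤δ) → subst (λ p → ∣ p ∣ ℚ.≤ ε) (sym (ℚ.+-identityʳ (psum (conv (f n) (g n)) m)))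
    (ℚ.≤-trans (conv-smoothed (f n) (g n) f≲K m)
      (subst (K * smoothed (g n) m ℚ.≤_) total
        (ℚ.*-monoˡ-≤-nonNeg K {{nonNegative (ℚ.<⇒≤ 0<K)}} (small n m ≤m g≲K g≤δ)))))
    f≲K (both (λ _ → _,_) g≲K (proj₂ (close g⇉0 (δ * ½) (half-pos 0<δ)) N (ℕ.m≤m⊔n N₁ N₂)))
  where
  reciprocal = recip (+-pos (+-pos 0<K 0<K) 0<K)
  r = proj₁ reciprocal
  δ = ε * r
  0<δ : 0ℚ ℚ.< δ
  0<δ = *-pos 0<ε (proj₁ (proj₂ reciprocal))
  total : K * ((δ + δ) + δ) ≡ ε
  total = trans (lemma K ε r) (trans (cong (ε *_) (proj₂ (proj₂ reciprocal))) (ℚ.*-identityʳ ε))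
    where
    lemma : ∀ K ε r → K * ((ε * r + ε * r) + ε * r) ≡ ε * (r * ((K + K) + K))
    lemma = solve 3 (λ K ε r → K :* ((ε :* r :+ ε :* r) :+ ε :* r) := ε :* (r :* ((K :+ K) :+ K))) refl
  2K = K + K
  0≤2K = ℚ.<⇒≤ (+-pos 0<K 0<K)
  N₁ = proj₁ (close g⇉0 (δ * ½) (half-pos 0<δ))
  N₂ = proj₁ (½^-vanish 0≤2K (δ * ½) (half-pos 0<δ))
  N = N₁ ℕ.⊔ N₂
  decay = ½^-vanish (+-nonNeg 0≤2K 0≤2K) δ 0<δ
  d₀ = proj₁ decay
  small : ∀ n m → d₀ ℕ.+ N ℕ.≤ m → Geometric (g n) K → ∣ psum (g n) N - 0ℚ ∣ ℚ.≤ δ * ½ →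
          smoothed (g n) m ℚ.≤ (δ + δ) + δ
  small n m ≤m g≲K g≤δ = subst (λ k → smoothed (g n) k ℚ.≤ (δ + δ) + δ)
    (ℕ.m∸n+n≡m (ℕ.≤-trans (ℕ.m≤n+m N d₀) ≤m))
    (ℚ.≤-trans
      (smoothed-tail (g n) N (psum-bound (g n) g≲K) (ℚ.<⇒≤ 0<δ) beyond (m ℕ.∸ N))
      (ℚ.+-monoʳ-≤ (δ + δ) (proj₂ decay (m ℕ.∸ N)
        (subst (ℕ._≤ m ℕ.∸ N) (ℕ.m+n∸n≡m d₀ N) (ℕ.∸-monoˡ-≤ N ≤m)))))
    where
    beyond : ∀ j → N ℕ.≤ j → ∣ psum (g n) j ∣ ℚ.≤ δ
    beyond j N≤j = ℚ.≤-trans (abs-bound (psum (g n) j) (psum (g n) N))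
      (widen (half+half δ) (ℚ.+-mono-≤
        (ℚ.≤-trans (subst (λ k → ∣ psum (g n) k - psum (g n) N ∣ ℚ.≤ 2K * ½ ^ℚ N) (ℕ.m+[n∸m]≡n N≤j)
          (psum-tail (g n) g≲K N (j ℕ.∸ N)))
          (proj₂ (½^-vanish 0≤2K (δ * ½) (half-pos 0<δ)) N (ℕ.m≤n⊔m N₁ N₂)))
        (subst (λ p → ∣ p ∣ ℚ.≤ δ * ½) (ℚ.+-identityʳ (psum (g n) N)) g≤δ)))

-- The exponential on an invariant plane

cos-null : ∀ θ → cos θ ≈ᴿ 0ᴿ → (λ m n → psum (cosTerm (approx θ n)) m) ⇉ (λ _ → 0ℚ)
cos-null θ cosθ≈0 .close ε 0<ε =
  each (λ m near → both (λ n a b →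
    subst (λ p → ∣ p ∣ ℚ.≤ ε) (sym (ℚ.+-identityʳ (psum (cosTerm (approx θ n)) m)))
    (ℚ.≤-trans (abs-bound (psum (cosTerm (approx θ n)) m) (approx (cos θ) n))
      (widen (half+half ε) (ℚ.+-mono-≤ (subst (λ p → ∣ p - approx (cos θ) n ∣ ℚ.≤ ε * ½) (partial-sum n m) a)
        (subst (λ p → ∣ p ∣ ℚ.≤ ε * ½) (ℚ.+-identityʳ (approx (cos θ) n)) b)))))
    near (cosθ≈0 (ε * ½) (half-pos 0<ε)))
    (close (⟶⇒⇉ (λ m → re (partialSum (expTerm X zero zero) m)) (cos θ)
      (proj₁ (proj₂ (exp-converges X zero zero)))) (ε * ½) (half-pos 0<ε))
  where
  X : Matrix 1
  X _ _ = θ ·ᶜ 𝕚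
  entry : ∀ n j → invFact j * approx (re ((X ^ᴹ j) zero zero)) n ≡ cosTerm (approx θ n) j
                × invFact j * approx (im ((X ^ᴹ j) zero zero)) n ≡ sinTerm (approx θ n) j
  entry n zero    = refl , refl
  entry n (suc j) =
    let cos-eq , sin-eq = entry n j
        x = approx θ n
        r = approx (re ((X ^ᴹ j) zero zero)) n
        i = approx (im ((X ^ᴹ j) zero zero)) n
    in trans (cong (_* (((x * 0ℚ) * r + - ((x * 1ℚ) * i)) + 0ℚ)) (invFact-suc j))
         (trans (re-lemma (unit j) (invFact j) x r i) (cong (λ t → unit j * - (x * t)) sin-eq))
     , trans (cong (_* (((x * 0ℚ) * i + (x * 1ℚ) * r) + 0ℚ)) (invFact-suc j))
         (trans (im-lemma (unit j) (invFact j) x r i) (cong (λ t → unit j * (x * t)) cos-eq))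
    where
    re-lemma : ∀ u v x r i → (u * v) * (((x * 0ℚ) * r + - ((x * 1ℚ) * i)) + 0ℚ) ≡ u * - (x * (v * i))
    re-lemma = solve 5 (λ u v x r i →
      (u :* v) :* (((x :* con 0ℚ) :* r :+ :- ((x :* con 1ℚ) :* i)) :+ con 0ℚ) := u :* :- (x :* (v :* i))) refl
    im-lemma : ∀ u v x r i → (u * v) * (((x * 0ℚ) * i + (x * 1ℚ) * r) + 0ℚ) ≡ u * (x * (v * r))
    im-lemma = solve 5 (λ u v x r i →
      (u :* v) :* (((x :* con 0ℚ) :* i :+ (x :* con 1ℚ) :* r) :+ con 0ℚ) := u :* (x :* (v :* r))) refl
  partial-sum : ∀ n m → approx (re (partialSum (expTerm X zero zero) m)) n ≡ psum (cosTerm (approx θ n)) m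
  partial-sum n zero    = refl
  partial-sum n (suc m) = trans (cong₂ _+_ (partial-sum n m) (proj₁ (entry n m)))
    (sym (psum-snoc (cosTerm (approx θ n)) m))

vCoefficient-null : ∀ D s θ → cos θ ≈ᴿ 0ᴿ →
  (λ m n → psum (vRe D s (approx θ n)) m) ⇉ (λ _ → 0ℚ) ×
  (λ m n → psum (vIm D s (approx θ n)) m) ⇉ (λ _ → 0ℚ)
vCoefficient-null D s θ cosθ≈0 =
  let B , 0<B , θ≤B = bounded θ
      0<c = ℚ.+-mono-≤-< (ℚ.0≤∣p∣ D) 0<1
      K , 0<K , terms = terms-geometric (*-pos 0<c 0<B)
      x = approx θ
      geo = each (λ n x≤B → terms (x n) (x≤ n B x≤B)) θ≤B
      geoD = each (λ n x≤B → terms (D * x n) (Dx≤ n B 0<B x≤B)) θ≤B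
      null = cos-null θ cosθ≈0
  in conv-null (λ n → cosTerm (D * x n)) (λ n → cosTerm (x n)) 0<K
       (each (λ _ → proj₁) geoD) (each (λ _ → proj₁) geo) null
   , conv-null (λ n → sinTerm (D * x n)) (λ n → cosTerm (x n)) 0<K
       (each (λ _ → proj₂) geoD) (each (λ _ → proj₁) geo) null
  where
  x≤ : ∀ n B → ∣ approx θ n ∣ ℚ.≤ B → ∣ approx θ n ∣ ℚ.≤ (∣ D ∣ + 1ℚ) * B
  x≤ n B x≤B = ℚ.≤-trans x≤B (subst₂ ℚ._≤_ (ℚ.*-identityˡ B) refl
    (ℚ.*-monoʳ-≤-nonNeg B {{nonNegative (ℚ.≤-trans (ℚ.0≤∣p∣ (approx θ n)) x≤B)}}
      (subst (ℚ._≤ ∣ D ∣ + 1ℚ) (ℚ.+-identityˡ 1ℚ) (ℚ.+-monoˡ-≤ 1ℚ (ℚ.0≤∣p∣ D)))))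
  Dx≤ : ∀ n B → 0ℚ ℚ.< B → ∣ approx θ n ∣ ℚ.≤ B → ∣ D * approx θ n ∣ ℚ.≤ (∣ D ∣ + 1ℚ) * B
  Dx≤ n B 0<B x≤B = subst (ℚ._≤ (∣ D ∣ + 1ℚ) * B) (sym (ℚ.∣p*q∣≡∣p∣*∣q∣ D (approx θ n)))
    (*-mono (+-nonNeg (ℚ.0≤∣p∣ D) (ℚ.<⇒≤ 0<1)) (ℚ.0≤∣p∣ (approx θ n))
      (≤-weaken (ℚ.≤-refl {∣ D ∣}) (ℚ.<⇒≤ 0<1)) x≤B)

ind : Bool → ℚ
ind t = if t then 1ℚ else 0ℚ

δ : ∀ {n} → Fin n → Fin n → ℚ
δ a x = ind (does (a Fin.≟ x))

pairℚ : ∀ {n} → Fin n → Fin n → Fin n → ℚ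
pairℚ a b x = δ a x - δ b x

δ-refl : ∀ {n} (a : Fin n) → δ a a ≡ 1ℚ
δ-refl a with a Fin.≟ a
... | yes _   = refl
... | no  a≢a = contradiction refl a≢a

δ-≢ : ∀ {n} {a b : Fin n} → a ≢ b → δ a b ≡ 0ℚ
δ-≢ {a = a} {b} a≢b with a Fin.≟ b
... | yes a≡b = contradiction a≡b a≢b
... | no  _   = refl

δ-sym : ∀ {n} (a b : Fin n) → δ a b ≡ δ b a
δ-sym a b with a Fin.≟ b
... | yes refl = sym (δ-refl a)
... | no  a≢b  = sym (δ-≢ (≢-sym a≢b))

if-ind : ∀ t n → approx (re (if t then 1ᶜ else 0ᶜ)) n ≡ ind t × approx (im (if t then 1ᶜ else 0ᶜ)) n ≡ 0ℚ
if-ind true  n = refl , refl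
if-ind false n = refl , refl

sum-zero : ∀ {n} {f : Fin n → ℚ} → (∀ z → f z ≡ 0ℚ) → sum f ≡ 0ℚ
sum-zero {zero}  f≗0 = refl
sum-zero {suc n} f≗0 = cong₂ _+_ (f≗0 zero) (sum-zero (λ z → f≗0 (suc z)))

sum-linear : ∀ {n} p q (r f g : Fin n → ℚ) →
  sum (λ z → r z * (p * f z + q * g z)) ≡ p * sum (λ z → r z * f z) + q * sum (λ z → r z * g z)
sum-linear {zero}  p q r f g = lemma p q
  where
  lemma : ∀ p q → 0ℚ ≡ p * 0ℚ + q * 0ℚ
  lemma = solve 2 (λ p q → con 0ℚ := p :* con 0ℚ :+ q :* con 0ℚ) refl
sum-linear {suc n} p q r f g = trans
  (cong (r zero * (p * f zero + q * g zero) +_)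
    (sum-linear p q (λ z → r (suc z)) (λ z → f (suc z)) (λ z → g (suc z))))
  (lemma p q (r zero) (f zero) (g zero) _ _)
  where
  lemma : ∀ p q r a b s t → r * (p * a + q * b) + (p * s + q * t) ≡ p * (r * a + s) + q * (r * b + t)
  lemma = solve 7 (λ p q r a b s t →
    r :* (p :* a :+ q :* b) :+ (p :* s :+ q :* t) := p :* (r :* a :+ s) :+ q :* (r :* b :+ t)) refl

sum-δ : ∀ {n} (r : Fin n → ℚ) a → sum (λ z → r z * δ a z) ≡ r a
sum-δ {suc n} r zero    = trans
  (cong (r zero * 1ℚ +_) (sum-zero {n} {λ z → r (suc z) * 0ℚ} (λ z → ℚ.*-zeroʳ (r (suc z)))))
  (trans (ℚ.+-identityʳ (r zero * 1ℚ)) (ℚ.*-identityʳ (r zero)))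
sum-δ {suc n} r (suc a) = trans
  (cong₂ _+_ (ℚ.*-zeroʳ (r zero)) (sum-δ (λ z → r (suc z)) a)) (ℚ.+-identityˡ (r (suc a)))

sum-pair : ∀ {n} (r : Fin n → ℚ) a b → sum (λ z → r z * pairℚ a b z) ≡ r a - r b
sum-pair r a b = trans (sum-cong-≗ (λ z → cong (r z *_) (lemma₁ (δ a z) (δ b z))))
  (trans (sum-linear 1ℚ (- 1ℚ) r (δ a) (δ b))
    (trans (cong₂ (λ p q → 1ℚ * p + - 1ℚ * q) (sum-δ r a) (sum-δ r b)) (sym (lemma₁ (r a) (r b)))))
  where
  lemma₁ : ∀ p q → p - q ≡ 1ℚ * p + - 1ℚ * q
  lemma₁ = solve 2 (λ p q → p :- q := con 1ℚ :* p :+ con (- 1ℚ) :* q) refl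

sum-factor : ∀ {n} u i c (r f g : Fin n → ℚ) →
  (u * i) * (sum (λ z → c * (r z * f z)) - sum (λ z → c * (r z * g z)))
    ≡ u * (c * sum (λ z → r z * (i * (f z - g z))))
sum-factor {zero}  u i c r f g = lemma u i c
  where
  lemma : ∀ u i c → (u * i) * (0ℚ - 0ℚ) ≡ u * (c * 0ℚ)
  lemma = solve 3 (λ u i c → (u :* i) :* (con 0ℚ :- con 0ℚ) := u :* (c :* con 0ℚ)) refl
sum-factor {suc n} u i c r f g = trans
  (lemma₁ u i c (r zero) (f zero) (g zero) _ _)
  (trans (cong (u * (c * (r zero * (i * (f zero - g zero)))) +_)
      (sum-factor u i c (λ z → r (suc z)) (λ z → f (suc z)) (λ z → g (suc z))))
    (lemma₂ u c _ _))
  where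
  lemma₁ : ∀ u i c r f g s t → (u * i) * ((c * (r * f) + s) - (c * (r * g) + t))
    ≡ u * (c * (r * (i * (f - g)))) + (u * i) * (s - t)
  lemma₁ = solve 8 (λ u i c r f g s t → (u :* i) :* ((c :* (r :* f) :+ s) :- (c :* (r :* g) :+ t))
    := u :* (c :* (r :* (i :* (f :- g)))) :+ (u :* i) :* (s :- t)) refl
  lemma₂ : ∀ u c p q → u * (c * p) + u * (c * q) ≡ u * (c * (p + q))
  lemma₂ = solve 4 (λ u c p q → u :* (c :* p) :+ u :* (c :* q) := u :* (c :* (p :+ q))) refl

sumᶜ-approx : ∀ {N} (f : Vec N) n →
  approx (re (sumᶜ f)) n ≡ sum (λ z → approx (re (f z)) n) ×
  approx (im (sumᶜ f)) n ≡ sum (λ z → approx (im (f z)) n)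
sumᶜ-approx {zero}  f n = refl , refl
sumᶜ-approx {suc N} f n =
  let re-eq , im-eq = sumᶜ-approx (λ z → f (suc z)) n
  in cong (approx (re (f zero)) n +_) re-eq , cong (approx (im (f zero)) n +_) im-eq

Represents : ∀ {N} → Matrix N → (Fin N → Fin N → ℚ) → Set
Represents M R = ∀ u v n → approx (re (M u v)) n ≡ R u v × approx (im (M u v)) n ≡ 0ℚ

pair-approx : ∀ {N} (a b : Fin N) x n →
  approx (re (pair a b x)) n ≡ pairℚ a b x × approx (im (pair a b x)) n ≡ 0ℚ
pair-approx a b x n =
  let re-a , im-a = if-ind (does (a Fin.≟ x)) n
      re-b , im-b = if-ind (does (b Fin.≟ x)) n
  in cong₂ _-_ re-a re-b , cong₂ _-_ im-a im-b

module Transfer {N} (M : Matrix N) (R : Fin N → Fin N → ℚ) (M≗R : Represents M R)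
  (a b c d : Fin N) (a≢b : a ≢ b) (c≢d : c ≢ d) (c≢a : c ≢ a) (c≢b : c ≢ b)
  (D s : ℚ) (s*s≡1 : s * s ≡ 1ℚ)
  (R-ab : ∀ u → R u a - R u b ≡ D * pairℚ a b u + s * pairℚ c d u)
  (R-cd : ∀ u → R u c - R u d ≡ s * pairℚ a b u + D * pairℚ c d u)
  (θ : ℝ) (cosθ≈0 : cos θ ≈ᴿ 0ᴿ)
  where

  v w : Fin N → ℚ
  v = pairℚ a b
  w = pairℚ c d

  vc≡0 : v c ≡ 0ℚ
  vc≡0 = cong₂ _-_ (δ-≢ (≢-sym c≢a)) (δ-≢ (≢-sym c≢b))

  wc≡1 : w c ≡ 1ℚ
  wc≡1 = cong₂ _-_ (δ-refl c) (δ-≢ (≢-sym c≢d))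

  X : Matrix N
  X = (θ ·ᶜ 𝕚) ·ᴹ M

  module _ (n : ℕ) where
    x : ℚ
    x = approx θ n

    private
      VRe = vRe D s x
      VIm = vIm D s x
      WRe = wRe D s x
      WIm = wIm D s x

    reP imP : ℕ → Fin N → Fin N → ℚ
    reP j u t = approx (re ((X ^ᴹ j) u t)) n
    imP j u t = approx (im ((X ^ᴹ j) u t)) n

    reP-suc : ∀ j u t → reP (suc j) u t ≡ sum (λ z → - x * (R u z * imP j z t))
    reP-suc j u t = trans (proj₁ (sumᶜ-approx (λ z → X u z *ᶜ (X ^ᴹ j) z t) n)) (sum-cong-≗ λ z →
      trans (cong₂ (λ ρ ι → (x * 0ℚ * ρ - x * 1ℚ * ι) * reP j z t - (x * 0ℚ * ι + x * 1ℚ * ρ) * imP j z t)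
          (proj₁ (M≗R u z n)) (proj₂ (M≗R u z n)))
        (lemma x (R u z) (reP j z t) (imP j z t)))
      where
      lemma : ∀ x ρ p q → (x * 0ℚ * ρ - x * 1ℚ * 0ℚ) * p - (x * 0ℚ * 0ℚ + x * 1ℚ * ρ) * q ≡ - x * (ρ * q)
      lemma = solve 4 (λ x ρ p q →
        (x :* con 0ℚ :* ρ :- x :* con 1ℚ :* con 0ℚ) :* p :- (x :* con 0ℚ :* con 0ℚ :+ x :* con 1ℚ :* ρ) :* q
        := :- x :* (ρ :* q)) refl

    imP-suc : ∀ j u t → imP (suc j) u t ≡ sum (λ z → x * (R u z * reP j z t))
    imP-suc j u t = trans (proj₂ (sumᶜ-approx (λ z → X u z *ᶜ (X ^ᴹ j) z t) n)) (sum-cong-≗ λ z →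
      trans (cong₂ (λ ρ ι → (x * 0ℚ * ρ - x * 1ℚ * ι) * imP j z t + (x * 0ℚ * ι + x * 1ℚ * ρ) * reP j z t)
          (proj₁ (M≗R u z n)) (proj₂ (M≗R u z n)))
        (lemma x (R u z) (reP j z t) (imP j z t)))
      where
      lemma : ∀ x ρ p q → (x * 0ℚ * ρ - x * 1ℚ * 0ℚ) * q + (x * 0ℚ * 0ℚ + x * 1ℚ * ρ) * p ≡ x * (ρ * p)
      lemma = solve 4 (λ x ρ p q →
        (x :* con 0ℚ :* ρ :- x :* con 1ℚ :* con 0ℚ) :* q :+ (x :* con 0ℚ :* con 0ℚ :+ x :* con 1ℚ :* ρ) :* p
        := x :* (ρ :* p)) refl

    R-combination : ∀ p q u → sum (λ z → R u z * (p * v z + q * w z))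
                    ≡ (D * p + s * q) * v u + (s * p + D * q) * w u
    R-combination p q u = trans (sum-linear p q (R u) v w)
      (trans (cong₂ (λ e f → p * e + q * f)
          (trans (sum-pair (R u) a b) (R-ab u)) (trans (sum-pair (R u) c d) (R-cd u)))
        (lemma p q D s (v u) (w u)))
      where
      lemma : ∀ p q D s v w → p * (D * v + s * w) + q * (s * v + D * w) ≡ (D * p + s * q) * v + (s * p + D * q) * w
      lemma = solve 6 (λ p q D s v w → p :* (D :* v :+ s :* w) :+ q :* (s :* v :+ D :* w)
        := (D :* p :+ s :* q) :* v :+ (s :* p :+ D :* q) :* w) refl

    terms : ∀ j u → invFact j * (reP j u a - reP j u b) ≡ VRe j * v u + WRe j * w u
                  × invFact j * (imP j u a - imP j u b) ≡ VIm j * v u + WIm j * w u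
    terms zero u =
      let re-a , im-a = if-ind (does (u Fin.≟ a)) n
          re-b , im-b = if-ind (does (u Fin.≟ b)) n
      in trans (cong (1ℚ *_) (cong₂ _-_ (trans re-a (δ-sym u a)) (trans re-b (δ-sym u b))))
           (re-lemma s (v u) (w u))
       , trans (cong (1ℚ *_) (cong₂ _-_ im-a im-b)) (im-lemma s (v u) (w u))
      where
      re-lemma : ∀ s v w → 1ℚ * v ≡ (1ℚ * 1ℚ) * v + (- s * (0ℚ * 0ℚ)) * w
      re-lemma = solve 3 (λ s v w →
        con 1ℚ :* v := (con 1ℚ :* con 1ℚ) :* v :+ (:- s :* (con 0ℚ :* con 0ℚ)) :* w) refl
      im-lemma : ∀ s v w → 1ℚ * (0ℚ - 0ℚ) ≡ (0ℚ * 1ℚ) * v + (s * (1ℚ * 0ℚ)) * w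
      im-lemma = solve 3 (λ s v w → con 1ℚ :* (con 0ℚ :- con 0ℚ)
        := (con 0ℚ :* con 1ℚ) :* v :+ (s :* (con 1ℚ :* con 0ℚ)) :* w) refl
    terms (suc j) u =
      trans (step (- x) (reP-suc j u) (λ z → proj₂ (terms j z)))
        (trans (re-lemma (unit j) x D s (VIm j) (WIm j) (v u) (w u))
          (cong₂ (λ e f → e * v u + f * w u) (sym (vRe-suc D s x s*s≡1 j)) (sym (wRe-suc D s x j)))) ,
      trans (step x (imP-suc j u) (λ z → proj₁ (terms j z)))
        (trans (im-lemma (unit j) x D s (VRe j) (WRe j) (v u) (w u))
          (cong₂ (λ e f → e * v u + f * w u) (sym (vIm-suc D s x s*s≡1 j)) (sym (wIm-suc D s x j))))
      where
      step : ∀ k {P : Fin N → ℚ} {Q : Fin N → Fin N → ℚ} {p q} →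
             (∀ t → P t ≡ sum (λ z → k * (R u z * Q z t))) →
             (∀ z → invFact j * (Q z a - Q z b) ≡ p * v z + q * w z) →
             invFact (suc j) * (P a - P b) ≡ unit j * (k * ((D * p + s * q) * v u + (s * p + D * q) * w u))
      step k {P} {Q} {p} {q} P-eq Q-eq = trans (cong₂ _*_ (invFact-suc j) (cong₂ _-_ (P-eq a) (P-eq b)))
        (trans (sum-factor (unit j) (invFact j) k (R u) (λ z → Q z a) (λ z → Q z b))
          (cong (λ t → unit j * (k * t))
            (trans (sum-cong-≗ (λ z → cong (R u z *_) (Q-eq z))) (R-combination p q u))))
      re-lemma : ∀ t x D s p q v w → t * (- x * ((D * p + s * q) * v + (s * p + D * q) * w))
        ≡ (t * - (x * (D * p + s * q))) * v + (t * - (x * (s * p + D * q))) * w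
      re-lemma = solve 8 (λ t x D s p q v w → t :* (:- x :* ((D :* p :+ s :* q) :* v :+ (s :* p :+ D :* q) :* w))
        := (t :* :- (x :* (D :* p :+ s :* q))) :* v :+ (t :* :- (x :* (s :* p :+ D :* q))) :* w) refl
      im-lemma : ∀ t x D s p q v w → t * (x * ((D * p + s * q) * v + (s * p + D * q) * w))
        ≡ (t * (x * (D * p + s * q))) * v + (t * (x * (s * p + D * q))) * w
      im-lemma = solve 8 (λ t x D s p q v w → t :* (x :* ((D :* p :+ s :* q) :* v :+ (s :* p :+ D :* q) :* w))
        := (t :* (x :* (D :* p :+ s :* q))) :* v :+ (t :* (x :* (s :* p :+ D :* q))) :* w) refl

  -- One proof for the real and for the imaginary part, both selected by part.
  module Part (part : ℂ → ℝ)
    (part-sum : ∀ f m n → approx (part (partialSum f m)) n ≡ psum (λ j → approx (part (f j)) n) m)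
    (converges : ∀ u t → (λ m → part (partialSum (expTerm X u t) m)) ⟶ part (exp X u t))
    (α β : ℕ → ℕ → ℚ)
    (part-terms : ∀ j u n → approx (part (expTerm X u a j)) n - approx (part (expTerm X u b j)) n
                            ≡ α n j * v u + β n j * w u)
    (α-null : (λ m n → psum (α n) m) ⇉ (λ _ → 0ℚ))
    where

    E : Fin N → ℕ → ℚ
    E u n = approx (part (exp X u a)) n - approx (part (exp X u b)) n

    difference : ∀ p q → p + - 1ℚ * q ≡ p - q
    difference = solve 2 (λ p q → p :+ con (- 1ℚ) :* q := p :- q) refl

    limit : ∀ u → (λ m n → v u * psum (α n) m + w u * psum (β n) m) ⇉ E u
    limit u = ⇉-cong sums (λ n → difference (approx (part (exp X u a)) n) (approx (part (exp X u b)) n))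
      (⇉-+ (entry-limit a) (⇉-scale (- 1ℚ) (entry-limit b)))
      where
      entry-limit = λ t → ⟶⇒⇉ (λ m → part (partialSum (expTerm X u t) m)) (part (exp X u t)) (converges u t)
      f g : ℕ → ℕ → ℚ
      f n j = approx (part (expTerm X u a j)) n
      g n j = approx (part (expTerm X u b j)) n
      sums : ∀ m n → approx (part (partialSum (expTerm X u a) m)) n
                     + - 1ℚ * approx (part (partialSum (expTerm X u b) m)) n
                     ≡ v u * psum (α n) m + w u * psum (β n) m
      sums m n = trans (cong₂ (λ p q → p + - 1ℚ * q)
          (part-sum (expTerm X u a) m n) (part-sum (expTerm X u b) m n))
        (trans (cong (_+ - 1ℚ * psum (g n) m) (sym (ℚ.*-identityˡ (psum (f n) m))))
        (trans (sym (psum-linear 1ℚ (- 1ℚ) (f n) (g n) m))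
        (trans (psum-cong (λ j → trans (trans (lemma (f n j) (g n j)) (part-terms j u n))
            (cong₂ _+_ (ℚ.*-comm (α n j) (v u)) (ℚ.*-comm (β n j) (w u)))) m)
          (psum-linear (v u) (w u) (α n) (β n) m))))
        where
        lemma : ∀ p q → 1ℚ * p + - 1ℚ * q ≡ p - q
        lemma = solve 2 (λ p q → con 1ℚ :* p :+ con (- 1ℚ) :* q := p :- q) refl

    β-limit : (λ m n → psum (β n) m) ⇉ E c
    β-limit = ⇉-cong (λ m n → trans (cong₂ (λ p q → p * psum (α n) m + q * psum (β n) m) vc≡0 wc≡1)
      (lemma (psum (α n) m) (psum (β n) m))) (λ _ → refl) (limit c)
      where
      lemma : ∀ p q → 0ℚ * p + 1ℚ * q ≡ q
      lemma = solve 2 (λ p q → con 0ℚ :* p :+ con 1ℚ :* q := q) refl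

    proportional : ∀ u ε → 0ℚ ℚ.< ε → Eventually λ n → ∣ E u n - E c n * w u ∣ ℚ.≤ ε
    proportional u = ⇉-unique (limit u)
      (⇉-cong (λ _ _ → refl) (λ n → lemma (v u) (w u) (E c n))
        (⇉-+ (⇉-scale (v u) α-null) (⇉-scale (w u) β-limit)))
      where
      lemma : ∀ v w e → v * 0ℚ + w * e ≡ e * w
      lemma = solve 3 (λ v w e → v :* con 0ℚ :+ w :* e := e :* w) refl

  factor : ∀ p q r → p * q - p * r ≡ p * (q - r)
  factor = solve 3 (λ p q r → p :* q :- p :* r := p :* (q :- r)) refl

  re-sum : ∀ f m n → approx (re (partialSum f m)) n ≡ psum (λ j → approx (re (f j)) n) m
  re-sum f zero    n = refl
  re-sum f (suc m) n = trans (cong (_+ approx (re (f m)) n) (re-sum f m n))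
    (sym (psum-snoc (λ j → approx (re (f j)) n) m))

  im-sum : ∀ f m n → approx (im (partialSum f m)) n ≡ psum (λ j → approx (im (f j)) n) m
  im-sum f zero    n = refl
  im-sum f (suc m) n = trans (cong (_+ approx (im (f m)) n) (im-sum f m n))
    (sym (psum-snoc (λ j → approx (im (f j)) n) m))

  α-null = vCoefficient-null D s θ cosθ≈0

  module Re = Part re re-sum (λ u t → proj₁ (proj₂ (exp-converges X u t)))
    (λ n → vRe D s (approx θ n)) (λ n → wRe D s (approx θ n))
    (λ j u n → trans (factor (invFact j) (reP n j u a) (reP n j u b)) (proj₁ (terms n j u))) (proj₁ α-null)
  module Im = Part im im-sum (λ u t → proj₂ (proj₂ (exp-converges X u t)))
    (λ n → vIm D s (approx θ n)) (λ n → wIm D s (approx θ n))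
    (λ j u n → trans (factor (invFact j) (imP n j u a) (imP n j u b)) (proj₂ (terms n j u))) (proj₂ α-null)

  γ : ℂ
  γ = exp X c a -ᶜ exp X c b

  image-approx : ∀ u n → approx (re ((exp X *ᵛ pair a b) u)) n ≡ Re.E u n
                       × approx (im ((exp X *ᵛ pair a b) u)) n ≡ Im.E u n
  image-approx u n =
    trans (proj₁ (sumᶜ-approx (λ z → exp X u z *ᶜ pair a b z) n))
      (trans (sum-cong-≗ λ z → trans (cong₂ (λ p q → r z * p - i z * q)
          (proj₁ (pair-approx a b z n)) (proj₂ (pair-approx a b z n))) (re-lemma (r z) (i z) (v z)))
        (sum-pair r a b)) ,
    trans (proj₂ (sumᶜ-approx (λ z → exp X u z *ᶜ pair a b z) n))
      (trans (sum-cong-≗ λ z → trans (cong₂ (λ p q → r z * q + i z * p)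
          (proj₁ (pair-approx a b z n)) (proj₂ (pair-approx a b z n))) (im-lemma (r z) (i z) (v z)))
        (sum-pair i a b))
    where
    r i : Fin N → ℚ
    r z = approx (re (exp X u z)) n
    i z = approx (im (exp X u z)) n
    re-lemma : ∀ r i p → r * p - i * 0ℚ ≡ r * p
    re-lemma = solve 3 (λ r i p → r :* p :- i :* con 0ℚ := r :* p) refl
    im-lemma : ∀ r i p → r * 0ℚ + i * p ≡ i * p
    im-lemma = solve 3 (λ r i p → r :* con 0ℚ :+ i :* p := i :* p) refl

  target-approx : ∀ u n → approx (re ((γ ·ᵛ pair c d) u)) n ≡ Re.E c n * w u
                        × approx (im ((γ ·ᵛ pair c d) u)) n ≡ Im.E c n * w u
  target-approx u n =
    trans (cong₂ (λ p q → Re.E c n * p - Im.E c n * q)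
      (proj₁ (pair-approx c d u n)) (proj₂ (pair-approx c d u n))) (re-lemma (Re.E c n) (Im.E c n) (w u)) ,
    trans (cong₂ (λ p q → Re.E c n * q + Im.E c n * p)
      (proj₁ (pair-approx c d u n)) (proj₂ (pair-approx c d u n))) (im-lemma (Re.E c n) (Im.E c n) (w u))
    where
    re-lemma : ∀ r i p → r * p - i * 0ℚ ≡ r * p
    re-lemma = solve 3 (λ r i p → r :* p :- i :* con 0ℚ := r :* p) refl
    im-lemma : ∀ r i p → r * 0ℚ + i * p ≡ i * p
    im-lemma = solve 3 (λ r i p → r :* con 0ℚ :+ i :* p := i :* p) refl

  transfers : exp X *ᵛ pair a b ≈ᵛ γ ·ᵛ pair c d
  transfers u =
    (λ ε 0<ε → each (λ n → subst (ℚ._≤ ε) (cong₂ (λ p q → ∣ p - q ∣)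
      (sym (proj₁ (image-approx u n))) (sym (proj₁ (target-approx u n))))) (Re.proportional u ε 0<ε)) ,
    (λ ε 0<ε → each (λ n → subst (ℚ._≤ ε) (cong₂ (λ p q → ∣ p - q ∣)
      (sym (proj₂ (image-approx u n))) (sym (proj₂ (target-approx u n))))) (Im.proportional u ε 0<ε))

  1≰½ : ¬ 1ℚ ℚ.≤ ½
  1≰½ p with ℚ.≤⇒≤ᵇ p
  ... | ()

  pairs-apart : ∀ {f : Vec N} → (∀ n → approx (re (f c)) n ≡ 0ℚ) → ¬ pair c d ≈ᵛ f
  pairs-apart fc≗0 pair≈f =
    let M , near = proj₁ (pair≈f c) ½ (half-pos 0<1)
    in 1≰½ (subst (ℚ._≤ ½) (cong₂ (λ p q → ∣ p - q ∣)
         (trans (proj₁ (pair-approx c d c M)) wc≡1) (fc≗0 M)) (near M ℕ.≤-refl))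

  pair-state-transfer : PairStateTransfer M θ a b c d
  pair-state-transfer = record
    { a≢b = a≢b
    ; c≢d = c≢d
    ; distinct = pairs-apart {pair a b} (λ n → trans (proj₁ (pair-approx a b c n)) vc≡0)
    ; opposite = pairs-apart { -ᵛ pair a b} (λ n → cong -_ (trans (proj₁ (pair-approx a b c n)) vc≡0))
    ; transfer = γ , transfers
    }

-- Graphs

does-refl : ∀ {n} (p : Fin n) → does (p Fin.≟ p) ≡ true
does-refl zero    = refl
does-refl (suc p) = does-refl p

does-≢ : ∀ {n} {p q : Fin n} → p ≢ q → does (p Fin.≟ q) ≡ false
does-≢ {p = p} {q} p≢q with p Fin.≟ q
... | yes p≡q = contradiction p≡q p≢q
... | no  _   = refl

Edge : (G : Graph) → Vertex G → Vertex G → Set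
Edge G u v = adj G u v ≡ true

record SwappedPairs (G : Graph) (a b c d : Vertex G) : Set where
  field
    a≢b : a ≢ b
    c≢d : c ≢ d
    c≢a : c ≢ a
    c≢b : c ≢ b
    valency-a : valency G a ≡ 2
    valency-b : valency G b ≡ 2
    valency-c : valency G c ≡ 2
    valency-d : valency G d ≡ 2
    adj-ab : ∀ u → ind (adj G u a) - ind (adj G u b) ≡ pairℚ c d u
    adj-cd : ∀ u → ind (adj G u c) - ind (adj G u d) ≡ pairℚ a b u

module _ {G a b c d} (swapped : SwappedPairs G a b c d) where
  open SwappedPairs swapped

  private
    Aℚ Δℚ : Vertex G → Vertex G → ℚ
    Aℚ u v = ind (adj G u v)
    Δℚ u v = if does (u Fin.≟ v) then ℤ.+ valency G u / 1 else 0ℚ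

    2ℚ : ℚ
    2ℚ = ℤ.+ 2 / 1

    A-represents : Represents (A G) Aℚ
    A-represents u v = if-ind (adj G u v)

    Δ-represents : Represents (Δ G) Δℚ
    Δ-represents u v n with does (u Fin.≟ v)
    ... | true  = refl , refl
    ... | false = refl , refl

    Δ-column : ∀ {t} → valency G t ≡ 2 → ∀ u → Δℚ u t ≡ 2ℚ * δ t u
    Δ-column {t} val u with u Fin.≟ t
    ... | yes refl = trans (cong (λ k → ℤ.+ k / 1) val) (cong (2ℚ *_) (sym (δ-refl u)))
    ... | no  u≢t  = sym (trans (cong (2ℚ *_) (δ-≢ (≢-sym u≢t))) (ℚ.*-zeroʳ 2ℚ))

    Δ-pair : ∀ {s t} → valency G s ≡ 2 → valency G t ≡ 2 → ∀ u → Δℚ u s - Δℚ u t ≡ 2ℚ * pairℚ s t u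
    Δ-pair {s} {t} val-s val-t u = trans (cong₂ _-_ (Δ-column val-s u) (Δ-column val-t u))
      (lemma 2ℚ (δ s u) (δ t u))
      where
      lemma : ∀ k p q → k * p - k * q ≡ k * (p - q)
      lemma = solve 3 (λ k p q → k :* p :- k :* q := k :* (p :- q)) refl

    L-lemma : ∀ p q r t {e f} → p - q ≡ e → r - t ≡ f → (p - r) - (q - t) ≡ e + (- 1ℚ) * f
    L-lemma p q r t pq rt = trans (lemma p q r t) (cong₂ (λ e f → e + (- 1ℚ) * f) pq rt)
      where
      lemma : ∀ p q r t → (p - r) - (q - t) ≡ (p - q) + (- 1ℚ) * (r - t)
      lemma = solve 4 (λ p q r t → (p :- r) :- (q :- t) := (p :- q) :+ con (- 1ℚ) :* (r :- t)) refl

    Q-lemma : ∀ p q r t {e f} → p - q ≡ e → r - t ≡ f → (p + r) - (q + t) ≡ e + 1ℚ * f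
    Q-lemma p q r t pq rt = trans (lemma p q r t) (cong₂ (λ e f → e + 1ℚ * f) pq rt)
      where
      lemma : ∀ p q r t → (p + r) - (q + t) ≡ (p - q) + 1ℚ * (r - t)
      lemma = solve 4 (λ p q r t → (p :+ r) :- (q :+ t) := (p :- q) :+ con 1ℚ :* (r :- t)) refl

    A-lemma : ∀ v w → w ≡ 0ℚ * v + 1ℚ * w
    A-lemma = solve 2 (λ v w → w := con 0ℚ :* v :+ con 1ℚ :* w) refl

  module _ {θ} (cosθ≈0 : cos θ ≈ᴿ 0ᴿ) where

    A-transfer : PairStateTransfer (A G) θ a b c d
    A-transfer = Transfer.pair-state-transfer (A G) Aℚ A-represents a b c d a≢b c≢d c≢a c≢b
      0ℚ 1ℚ refl
      (λ u → trans (adj-ab u) (A-lemma (pairℚ a b u) (pairℚ c d u)))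
      (λ u → trans (adj-cd u) (trans (A-lemma (pairℚ c d u) (pairℚ a b u))
        (ℚ.+-comm (0ℚ * pairℚ c d u) (1ℚ * pairℚ a b u))))
      θ cosθ≈0

    L-transfer : PairStateTransfer (L G) θ a b c d
    L-transfer = Transfer.pair-state-transfer (L G) (λ u v → Δℚ u v - Aℚ u v)
      (λ u v n →
        let re-Δ , im-Δ = Δ-represents u v n
            re-A , im-A = A-represents u v n
        in cong₂ _-_ re-Δ re-A , cong₂ _-_ im-Δ im-A)
      a b c d a≢b c≢d c≢a c≢b 2ℚ (- 1ℚ) refl
      (λ u → L-lemma (Δℚ u a) (Δℚ u b) (Aℚ u a) (Aℚ u b) (Δ-pair valency-a valency-b u) (adj-ab u))
      (λ u → trans (L-lemma (Δℚ u c) (Δℚ u d) (Aℚ u c) (Aℚ u d) (Δ-pair valency-c valency-d u) (adj-cd u))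
        (ℚ.+-comm (2ℚ * pairℚ c d u) ((- 1ℚ) * pairℚ a b u)))
      θ cosθ≈0

    Q-transfer : PairStateTransfer (Q G) θ a b c d
    Q-transfer = Transfer.pair-state-transfer (Q G) (λ u v → Δℚ u v + Aℚ u v)
      (λ u v n →
        let re-Δ , im-Δ = Δ-represents u v n
            re-A , im-A = A-represents u v n
        in cong₂ _+_ re-Δ re-A , cong₂ _+_ im-Δ im-A)
      a b c d a≢b c≢d c≢a c≢b 2ℚ 1ℚ refl
      (λ u → Q-lemma (Δℚ u a) (Δℚ u b) (Aℚ u a) (Aℚ u b) (Δ-pair valency-a valency-b u) (adj-ab u))
      (λ u → trans (Q-lemma (Δℚ u c) (Δℚ u d) (Aℚ u c) (Aℚ u d) (Δ-pair valency-c valency-d u) (adj-cd u))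
        (ℚ.+-comm (2ℚ * pairℚ c d u) (1ℚ * pairℚ a b u)))
      θ cosθ≈0

∣singleton∣ : ∀ {n} (p : Fin n) → Subset.∣ tabulate (λ v → does (p Fin.≟ v)) ∣ ≡ 1
∣singleton∣ {suc n} zero    = cong suc (∣empty∣ n)
  where
  ∣empty∣ : ∀ n → Subset.∣ tabulate {n = n} (λ _ → false) ∣ ≡ 0
  ∣empty∣ zero    = refl
  ∣empty∣ (suc n) = ∣empty∣ n
∣singleton∣ (suc p) = ∣singleton∣ p

addLeaf : (G : Graph) → Vertex G → Graph
addLeaf G p = record { order = suc (order G) ; adj = adj′ ; symm = symm′ ; irrefl = irrefl′ }
  where
  adj′ : Fin (suc (order G)) → Fin (suc (order G)) → Bool
  adj′ zero    zero    = false
  adj′ zero    (suc v) = does (p Fin.≟ v)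
  adj′ (suc u) zero    = does (p Fin.≟ u)
  adj′ (suc u) (suc v) = adj G u v
  symm′ : ∀ u v → adj′ u v ≡ adj′ v u
  symm′ zero    zero    = refl
  symm′ zero    (suc v) = refl
  symm′ (suc u) zero    = refl
  symm′ (suc u) (suc v) = symm G u v
  irrefl′ : ∀ v → adj′ v v ≡ false
  irrefl′ zero    = refl
  irrefl′ (suc v) = irrefl G v

module _ (G : Graph) (p : Vertex G) where

  valency-leaf : valency (addLeaf G p) zero ≡ 1
  valency-leaf = ∣singleton∣ p

  valency-parent : valency (addLeaf G p) (suc p) ≡ suc (valency G p)
  valency-parent rewrite does-refl p = refl

  valency-other : ∀ {v} → p ≢ v → valency (addLeaf G p) (suc v) ≡ valency G v
  valency-other p≢v rewrite does-≢ p≢v = refl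

  addLeaf-paths : ∀ {h} → (∀ v → Star (Edge G) v h) → ∀ v → Star (Edge (addLeaf G p)) v (suc h)
  addLeaf-paths paths zero    = does-refl p ◅ gmap suc (λ e → e) (paths p)
  addLeaf-paths paths (suc v) = gmap suc (λ e → e) (paths v)

  addLeaf-valency≤ : ∀ {k} → 1 ℕ.≤ k → valency G p ℕ.< k → (∀ v → valency G v ℕ.≤ k) →
                     ∀ v → valency (addLeaf G p) v ℕ.≤ k
  addLeaf-valency≤ 1≤k p<k ≤k zero    = ℕ.≤-trans (ℕ.≤-reflexive valency-leaf) 1≤k
  addLeaf-valency≤ 1≤k p<k ≤k (suc v) with p Fin.≟ v
  ... | yes refl = p<k
  ... | no  _    = ≤k v

  addLeaf-swapped : ∀ {a b c d} → p ≢ a → p ≢ b → p ≢ c → p ≢ d →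
                    SwappedPairs G a b c d → SwappedPairs (addLeaf G p) (suc a) (suc b) (suc c) (suc d)
  addLeaf-swapped p≢a p≢b p≢c p≢d swapped = record
    { a≢b = λ eq → a≢b (Fin.suc-injective eq)
    ; c≢d = λ eq → c≢d (Fin.suc-injective eq)
    ; c≢a = λ eq → c≢a (Fin.suc-injective eq)
    ; c≢b = λ eq → c≢b (Fin.suc-injective eq)
    ; valency-a = trans (valency-other p≢a) valency-a
    ; valency-b = trans (valency-other p≢b) valency-b
    ; valency-c = trans (valency-other p≢c) valency-c
    ; valency-d = trans (valency-other p≢d) valency-d
    ; adj-ab = λ where
        zero    → cong₂ (λ s t → ind s - ind t) (does-≢ p≢a) (does-≢ p≢b)
        (suc u) → adj-ab u
    ; adj-cd = λ where
        zero    → cong₂ (λ s t → ind s - ind t) (does-≢ p≢c) (does-≢ p≢d)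
        (suc u) → adj-cd u
    }
    where open SwappedPairs swapped

record Gadget (k : ℕ) : Set where
  field
    graph : Graph
    hub tip a b c d : Vertex graph
    swapped : SwappedPairs graph a b c d
    paths : ∀ v → Star (Edge graph) v hub
    valency-hub : valency graph hub ≡ k
    valency-tip : valency graph tip ≡ 1
    valency≤ : ∀ v → valency graph v ℕ.≤ k

module _ {k} (3≤k : 3 ℕ.≤ k) (G : Gadget k) where
  open Gadget G
  open SwappedPairs swapped

  private
    2<k : 2 ℕ.< k
    2<k = 3≤k

    1<k : 1 ℕ.< k
    1<k = ℕ.≤-trans (ℕ.n≤1+n 2) 3≤k

    valency-≢ : ∀ {u v m n} → valency graph u ≡ m → valency graph v ≡ n → m ≢ n → u ≢ v
    valency-≢ u≡m v≡n m≢n refl = m≢n (trans (sym u≡m) v≡n)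

    hub≢ : ∀ {v} → valency graph v ≡ 2 → hub ≢ v
    hub≢ val = valency-≢ valency-hub val (≢-sym (ℕ.<⇒≢ 2<k))

    tip≢ : ∀ {v} → valency graph v ≡ 2 → tip ≢ v
    tip≢ val = valency-≢ valency-tip val (λ ())

  growHub : Gadget (suc k)
  growHub = record
    { graph = addLeaf graph hub
    ; hub = suc hub ; tip = zero ; a = suc a ; b = suc b ; c = suc c ; d = suc d
    ; swapped = addLeaf-swapped graph hub
        (hub≢ valency-a) (hub≢ valency-b) (hub≢ valency-c) (hub≢ valency-d) swapped
    ; paths = addLeaf-paths graph hub paths
    ; valency-hub = trans (valency-parent graph hub) (cong suc valency-hub)
    ; valency-tip = valency-leaf graph hub
    ; valency≤ = addLeaf-valency≤ graph hub (ℕ.s≤s ℕ.z≤n) (ℕ.s≤s (valency≤ hub))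
        (λ v → ℕ.m≤n⇒m≤1+n (valency≤ v))
    }

  growTail : Gadget k
  growTail = record
    { graph = addLeaf graph tip
    ; hub = suc hub ; tip = zero ; a = suc a ; b = suc b ; c = suc c ; d = suc d
    ; swapped = addLeaf-swapped graph tip
        (tip≢ valency-a) (tip≢ valency-b) (tip≢ valency-c) (tip≢ valency-d) swapped
    ; paths = addLeaf-paths graph tip paths
    ; valency-hub = trans (valency-other graph tip (valency-≢ valency-tip valency-hub (ℕ.<⇒≢ 1<k))) valency-hub
    ; valency-tip = valency-leaf graph tip
    ; valency≤ = addLeaf-valency≤ graph tip (ℕ.<⇒≤ 1<k)
        (subst (ℕ._< k) (sym valency-tip) 1<k) valency≤
    }

  gadget-irregular : ¬ Regular graph
  gadget-irregular (r , regular) = ℕ.<⇒≢ 2<k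
    (trans (sym valency-a) (trans (regular a) (trans (sym (regular hub)) valency-hub)))

module _ {k} (G : Gadget k) where
  open Gadget G

  gadget-connected : Connected graph
  gadget-connected u v = paths u ◅◅ reverse (λ {x} {y} e → trans (symm graph y x) e) (paths v)

  gadget-maxValency : MaxValency graph k
  gadget-maxValency = valency≤ , hub , valency-hub

  gadget-transfer : ∃[ a ] ∃[ b ] ∃[ c ] ∃[ d ]
    PairStateTransfer (A graph) π/2 a b c d ×
    PairStateTransfer (L graph) π/2 a b c d ×
    PairStateTransfer (Q graph) π/2 a b c d
  gadget-transfer = a , b , c , d ,
    A-transfer swapped cos-π/2 , L-transfer swapped cos-π/2 , Q-transfer swapped cos-π/2
    where cos-π/2 = IsLeastPositiveZero.is-zero (proj₂ cos-least-zero)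

butterfly : Graph
butterfly = record
  { order = 5
  ; adj = edge
  ; symm = toWitness {a? = Fin.all? λ u → Fin.all? λ v → edge u v Bool.≟ edge v u} _
  ; irrefl = toWitness {a? = Fin.all? λ v → edge v v Bool.≟ false} _
  }
  where
  edge : Fin 5 → Fin 5 → Bool
  edge 0F      (suc _) = true
  edge (suc _) 0F      = true
  edge 1F      3F      = true
  edge 3F      1F      = true
  edge 2F      4F      = true
  edge 4F      2F      = true
  edge _       _       = false

butterfly-swapped : SwappedPairs butterfly 1F 2F 3F 4F
butterfly-swapped = record
  { a≢b = λ () ; c≢d = λ () ; c≢a = λ () ; c≢b = λ ()
  ; valency-a = refl ; valency-b = refl ; valency-c = refl ; valency-d = refl
  ; adj-ab = λ { 0F → refl ; 1F → refl ; 2F → refl ; 3F → refl ; 4F → refl }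
  ; adj-cd = λ { 0F → refl ; 1F → refl ; 2F → refl ; 3F → refl ; 4F → refl }
  }

smallest : Gadget 5
smallest = record
  { graph = addLeaf butterfly 0F
  ; hub = 1F ; tip = 0F ; a = 2F ; b = 3F ; c = 4F ; d = 5F
  ; swapped = addLeaf-swapped butterfly 0F (λ ()) (λ ()) (λ ()) (λ ()) butterfly-swapped
  ; paths = addLeaf-paths butterfly 0F λ where
      0F      → Star.ε
      (suc _) → refl ◅ Star.ε
  ; valency-hub = refl
  ; valency-tip = refl
  ; valency≤ = toWitness {a? = Fin.all? λ v → valency (addLeaf butterfly 0F) v ℕ.≤? 5} _
  }

3≤ : ∀ m → 3 ℕ.≤ m ℕ.+ 5
3≤ m = ℕ.≤-trans (ℕ.m≤m+n 3 2) (ℕ.m≤n+m 5 m)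

gadget : ∀ m → ℕ → Gadget (m ℕ.+ 5)
gadget m       (suc i) = growTail (3≤ m) (gadget m i)
gadget zero    zero    = smallest
gadget (suc m) zero    = growHub (3≤ m) (gadget m zero)

gadget-order : ∀ m i → order (Gadget.graph (gadget m i)) ≡ i ℕ.+ order (Gadget.graph (gadget m 0))
gadget-order m zero    = refl
gadget-order m (suc i) = cong suc (gadget-order m i)

≅⇒order≡ : ∀ {G H} → G ≅ H → order G ≡ order H
≅⇒order≡ iso = ↔⇒≡ (_≅_.vertices iso)

theorem13 : ∀ k → 5 ≤ k →
    Σ[ G ∈ (ℕ → Graph) ]
    (∀ i j → i ≢ j → ¬ (G i ≅ G j)) ×
    (∀ i →
    Connected (G i) ×
    ¬ Regular (G i) ×
    MaxValency (G i) k ×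
    (∃[ a ] ∃[ b ] ∃[ c ] ∃[ d ]
    PairStateTransfer (A (G i)) π/2 a b c d ×
    PairStateTransfer (L (G i)) π/2 a b c d ×
    PairStateTransfer (Q (G i)) π/2 a b c d))
theorem13 k 5≤k with k ℕ.∸ 5 | ℕ.m∸n+n≡m 5≤k
... | m | refl = (λ i → Gadget.graph (gadget m i)) ,
  (λ i j i≢j iso → i≢j (ℕ.+-cancelʳ-≡ (order (Gadget.graph (gadget m 0))) i j
    (trans (sym (gadget-order m i)) (trans (≅⇒order≡ iso) (gadget-order m j))))) ,
  (λ i → gadget-connected (gadget m i) , gadget-irregular (3≤ m) (gadget m i) ,
    gadget-maxValency (gadget m i) , gadget-transfer (gadget m i))
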